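{- Let $U\ne V$ be two values of the difference sequence $(\delta(n))$, with $u=\lambda(U)$, $v=\lambda(V)$, and write $U=|A-B\theta|$, $V=|p-q\theta|$ with $A,B,p,q\in\mathbb{N}_0$. Then the two-letter word $uv$ is a factor of $\Lambda_\theta$ if and only if $A/B$ and $p/q$ lie on opposite sides of $\theta$ and $|Aq-Bp|=1$.
   Context: Fix an irrational $\theta$ with $1<\theta<2$. Let $S(\theta)=\{i+j\theta : i,j\in\mathbb{N}_0\}$ and let $s_0<s_1<s_2<\cdots$ be its elements in increasing order. Put $\delta(n)=s_{n+1}-s_n$. Each $\delta(n)$ can be written uniquely as $|A-B\theta|$ with $A,B\in\mathbb{N}_0$. Let $\lambda$ be the map from the set of values $\{\delta(n):n\ge0\}$ to $\mathbb{N}_0$ that numbers the distinct values in order of first occurrence: $\lambda(\delta(0))=0$, and the $m$-th distinct value to appear in the sequence $\delta(0),\delta(1),\dots$ (counting from $m=0$) receives label $m$. The Lambda word is the right-infinite word $\Lambda_\theta=\lambda(\delta(0))\lambda(\delta(1))\lambda(\delta(2))\cdots$ over the alphabet $\mathbb{N}_0$. A factor is a finite block of consecutive letters. Fractions with denominator $0$ (value $+\infty$) are allowed.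
   Formalization: The word uv = 10 (U = θ−1, V = 1) is excluded: there 1/1 < θ < 1/0 and |1·0−1·1| = 1, but the difference 1 occurs only at n = 0, so 10 is never a factor and the stated equivalence fails for this one pair. -}

module Defs where

open import Algebra.Bundles.Raw using (RawMonoid)
import Algebra.Definitions.RawMonoid as RawMonoidDefs
open import Data.Empty using (⊥)
open import Data.Integer.Base using (+_)
open import Data.List.Base using (List; length; applyUpTo)
open import Data.Nat.Base as ℕ using (ℕ; zero; suc)
import Data.Nat.Properties as ℕ
open import Data.Product.Base using (_×_; _,_; ∃; ∃₂; proj₁; proj₂)
open import Data.Rational.Base as ℚ using (ℚ; 0ℚ; ½)
import Data.Rational.Properties as ℚ
open import Data.Rational.Solver using (module +-*-Solver)
open import Data.Sum.Base using (_⊎_; inj₁; inj₂)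
open import Data.Unit.Base using (⊤)
open import Level using (0ℓ)
open import Relation.Binary.PropositionalEquality
  using (_≡_; refl; sym; trans; cong; cong₂; subst)
open import Relation.Nullary.Negation using (¬_)
open import Relation.Unary using (Pred; _∈_)

------------------------------------------------------------------------
-- Real numbers: Cauchy sequences of rationals, with _≈_ as equality

IsCauchy : (ℕ → ℚ) → Set
IsCauchy x = ∀ ε → 0ℚ ℚ.< ε →
  ∃ λ N → ∀ m n → N ℕ.≤ m → N ℕ.≤ n → ℚ.∣ x m ℚ.- x n ∣ ℚ.< ε

record ℝ : Set where
  constructor mkℝ
  field
    seq    : ℕ → ℚ
    cauchy : IsCauchy seq

open ℝ public

infix 4 _≈_ _<_

_≈_ : ℝ → ℝ → Set
x ≈ y = ∀ ε → 0ℚ ℚ.< ε →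
  ∃ λ N → ∀ n → N ℕ.≤ n → ℚ.∣ seq x n ℚ.- seq y n ∣ ℚ.< ε

_<_ : ℝ → ℝ → Set
x < y = ∃ λ ε → 0ℚ ℚ.< ε ×
  ∃ λ N → ∀ n → N ℕ.≤ n → seq x n ℚ.+ ε ℚ.< seq y n

private
  0<½ε : ∀ {ε} → 0ℚ ℚ.< ε → 0ℚ ℚ.< ½ ℚ.* ε
  0<½ε {ε} 0<ε = subst (ℚ._< ½ ℚ.* ε) (ℚ.*-zeroʳ ½) (ℚ.*-monoʳ-<-pos ½ 0<ε)

  ½ε+½ε≡ε : ∀ ε → ½ ℚ.* ε ℚ.+ ½ ℚ.* ε ≡ ε
  ½ε+½ε≡ε ε = trans (sym (ℚ.*-distribʳ-+ ε ½ ½)) (ℚ.*-identityˡ ε)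

  interchange : ∀ a b c d →
    (a ℚ.+ b) ℚ.- (c ℚ.+ d) ≡ (a ℚ.- c) ℚ.+ (b ℚ.- d)
  interchange = solve 4
    (λ a b c d → (a :+ b) :- (c :+ d) := (a :- c) :+ (b :- d)) refl
    where open +-*-Solver

  [a-b]+b≡a : ∀ a b → (a ℚ.- b) ℚ.+ b ≡ a
  [a-b]+b≡a = solve 2 (λ a b → (a :- b) :+ b := a) refl
    where open +-*-Solver

  [a+b]-b≡a : ∀ a b → (a ℚ.+ b) ℚ.- b ≡ a
  [a+b]-b≡a = solve 2 (λ a b → (a :+ b) :- b := a) refl
    where open +-*-Solver

  -[a-b]≡b-a : ∀ a b → ℚ.- (a ℚ.- b) ≡ b ℚ.- a
  -[a-b]≡b-a = solve 2 (λ a b → :- (a :- b) := b :- a) refl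
    where open +-*-Solver

  ∣a∣-∣b∣≤∣a-b∣ : ∀ a b → ℚ.∣ a ∣ ℚ.- ℚ.∣ b ∣ ℚ.≤ ℚ.∣ a ℚ.- b ∣
  ∣a∣-∣b∣≤∣a-b∣ a b = begin
    ℚ.∣ a ∣ ℚ.- ℚ.∣ b ∣
      ≡⟨ cong (λ c → ℚ.∣ c ∣ ℚ.- ℚ.∣ b ∣) (sym ([a-b]+b≡a a b)) ⟩
    ℚ.∣ (a ℚ.- b) ℚ.+ b ∣ ℚ.- ℚ.∣ b ∣
      ≤⟨ ℚ.+-monoˡ-≤ (ℚ.- ℚ.∣ b ∣) (ℚ.∣p+q∣≤∣p∣+∣q∣ (a ℚ.- b) b) ⟩
    (ℚ.∣ a ℚ.- b ∣ ℚ.+ ℚ.∣ b ∣) ℚ.- ℚ.∣ b ∣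
      ≡⟨ [a+b]-b≡a ℚ.∣ a ℚ.- b ∣ ℚ.∣ b ∣ ⟩
    ℚ.∣ a ℚ.- b ∣ ∎
    where open ℚ.≤-Reasoning

  ∣a-b∣≡∣b-a∣ : ∀ a b → ℚ.∣ a ℚ.- b ∣ ≡ ℚ.∣ b ℚ.- a ∣
  ∣a-b∣≡∣b-a∣ a b =
    trans (sym (ℚ.∣-p∣≡∣p∣ (a ℚ.- b))) (cong ℚ.∣_∣ (-[a-b]≡b-a a b))

  ∣∣a∣-∣b∣∣≤∣a-b∣ : ∀ a b → ℚ.∣ ℚ.∣ a ∣ ℚ.- ℚ.∣ b ∣ ∣ ℚ.≤ ℚ.∣ a ℚ.- b ∣
  ∣∣a∣-∣b∣∣≤∣a-b∣ a b with ℚ.∣p∣≡p∨∣p∣≡-p (ℚ.∣ a ∣ ℚ.- ℚ.∣ b ∣)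
  ... | inj₁ eq = subst (ℚ._≤ ℚ.∣ a ℚ.- b ∣) (sym eq) (∣a∣-∣b∣≤∣a-b∣ a b)
  ... | inj₂ eq = begin
    ℚ.∣ ℚ.∣ a ∣ ℚ.- ℚ.∣ b ∣ ∣  ≡⟨ eq ⟩
    ℚ.- (ℚ.∣ a ∣ ℚ.- ℚ.∣ b ∣)  ≡⟨ -[a-b]≡b-a ℚ.∣ a ∣ ℚ.∣ b ∣ ⟩
    ℚ.∣ b ∣ ℚ.- ℚ.∣ a ∣        ≤⟨ ∣a∣-∣b∣≤∣a-b∣ b a ⟩
    ℚ.∣ b ℚ.- a ∣              ≡⟨ ∣a-b∣≡∣b-a∣ b a ⟩
    ℚ.∣ a ℚ.- b ∣              ∎
    where open ℚ.≤-Reasoning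

fromℚ : ℚ → ℝ
fromℚ q = mkℝ (λ _ → q) λ ε 0<ε → 0 , λ _ _ _ _ →
  subst (λ r → ℚ.∣ r ∣ ℚ.< ε) (sym (ℚ.+-inverseʳ q)) 0<ε

fromℕ : ℕ → ℝ
fromℕ n = fromℚ (+ n ℚ./ 1)

infixl 6 _+_ _-_
infix  8 -_

_+_ : ℝ → ℝ → ℝ
x + y = mkℝ (λ n → seq x n ℚ.+ seq y n) λ ε 0<ε →
  let N₁ , p = cauchy x (½ ℚ.* ε) (0<½ε 0<ε)
      N₂ , q = cauchy y (½ ℚ.* ε) (0<½ε 0<ε)
      open ℚ.≤-Reasoning
  in  N₁ ℕ.⊔ N₂ , λ m n N≤m N≤n → begin-strict
    ℚ.∣ (seq x m ℚ.+ seq y m) ℚ.- (seq x n ℚ.+ seq y n) ∣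
      ≡⟨ cong ℚ.∣_∣ (interchange (seq x m) (seq y m) (seq x n) (seq y n)) ⟩
    ℚ.∣ (seq x m ℚ.- seq x n) ℚ.+ (seq y m ℚ.- seq y n) ∣
      ≤⟨ ℚ.∣p+q∣≤∣p∣+∣q∣ (seq x m ℚ.- seq x n) (seq y m ℚ.- seq y n) ⟩
    ℚ.∣ seq x m ℚ.- seq x n ∣ ℚ.+ ℚ.∣ seq y m ℚ.- seq y n ∣
      <⟨ ℚ.+-mono-<
           (p m n (ℕ.m⊔n≤o⇒m≤o N₁ N₂ N≤m) (ℕ.m⊔n≤o⇒m≤o N₁ N₂ N≤n))
           (q m n (ℕ.m⊔n≤o⇒n≤o N₁ N₂ N≤m) (ℕ.m⊔n≤o⇒n≤o N₁ N₂ N≤n)) ⟩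
    ½ ℚ.* ε ℚ.+ ½ ℚ.* ε
      ≡⟨ ½ε+½ε≡ε ε ⟩
    ε ∎

-_ : ℝ → ℝ
- x = mkℝ (λ n → ℚ.- seq x n) λ ε 0<ε →
  let N , p = cauchy x ε 0<ε
  in  N , λ m n N≤m N≤n → subst (ℚ._< ε)
    (trans (sym (ℚ.∣-p∣≡∣p∣ (seq x m ℚ.- seq x n)))
           (cong ℚ.∣_∣ (ℚ.neg-distrib-+ (seq x m) (ℚ.- seq x n))))
    (p m n N≤m N≤n)

_-_ : ℝ → ℝ → ℝ
x - y = x + (- y)

∣_∣ : ℝ → ℝ
∣ x ∣ = mkℝ (λ n → ℚ.∣ seq x n ∣) λ ε 0<ε →
  let N , p = cauchy x ε 0<ε
  in  N , λ m n N≤m N≤n →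
    ℚ.≤-<-trans (∣∣a∣-∣b∣∣≤∣a-b∣ (seq x m) (seq x n)) (p m n N≤m N≤n)

+-0-rawMonoid : RawMonoid 0ℓ 0ℓ
+-0-rawMonoid = record { Carrier = ℝ ; _≈_ = _≈_ ; _∙_ = _+_ ; ε = fromℕ 0 }

-- n · x = x + (x + ⋯ ), the n-fold sum
open RawMonoidDefs +-0-rawMonoid public using () renaming (_×_ to infixr 8 _·_)

Irrational : ℝ → Set
Irrational x = ¬ (∃ λ q → x ≈ fromℚ q)

------------------------------------------------------------------------
-- The set S(θ), its increasing enumeration, and the differences

S : ℝ → Pred ℝ 0ℓ
S θ x = ∃₂ λ i j → x ≈ fromℕ i + j · θ

record IsIncreasingEnumeration (P : Pred ℝ 0ℓ) (s : ℕ → ℝ) : Set where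
  field
    increasing : ∀ n → s n < s (suc n)
    sound      : ∀ n → s n ∈ P
    complete   : ∀ x → x ∈ P → ∃ λ n → s n ≈ x

differences : (ℕ → ℝ) → (ℕ → ℝ)
differences s n = s (suc n) - s n

IsValueOf : (ℕ → ℝ) → Pred ℝ 0ℓ
IsValueOf δ x = ∃ λ n → δ n ≈ x

------------------------------------------------------------------------
-- Labelling of values in order of first occurrence

-- No earlier term of δ equals δ n.
IsNew : (ℕ → ℝ) → ℕ → Set
IsNew δ n = ∀ k → k ℕ.< n → ¬ (δ k ≈ δ n)

-- DistinctBefore δ n c : the terms δ 0, …, δ (n - 1) take exactly c
-- distinct values.
data DistinctBefore (δ : ℕ → ℝ) : ℕ → ℕ → Set where
  none : DistinctBefore δ 0 0
  old  : ∀ {n c} → DistinctBefore δ n c →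
         (∃ λ k → k ℕ.< n × δ k ≈ δ n) → DistinctBefore δ (suc n) c
  new  : ∀ {n c} → DistinctBefore δ n c →
         IsNew δ n → DistinctBefore δ (suc n) (suc c)

-- The graph of λ: x first occurs in δ after exactly m other values.  It is
-- a relation because a function would also need a proof that x is a value.
HasLabel : (ℕ → ℝ) → ℝ → ℕ → Set
HasLabel δ x m = ∃ λ n → δ n ≈ x × IsNew δ n × DistinctBefore δ n m

IsLambdaWord : (ℕ → ℝ) → (ℕ → ℕ) → Set
IsLambdaWord δ Λ = ∀ n → HasLabel δ (δ n) (Λ n)

------------------------------------------------------------------------
-- Factors of right-infinite words

IsFactorOf : List ℕ → (ℕ → ℕ) → Set
IsFactorOf w Λ = ∃ λ n → applyUpTo (λ k → Λ (n ℕ.+ k)) (length w) ≡ w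

------------------------------------------------------------------------
-- Position of the fraction a/b relative to x, where a/0 = +∞

FractionBelow : ℕ → ℕ → ℝ → Set
FractionBelow a zero      x = ⊥
FractionBelow a b@(suc _) x = fromℚ (+ a ℚ./ b) < x

FractionAbove : ℕ → ℕ → ℝ → Set
FractionAbove a zero      x = ⊤
FractionAbove a b@(suc _) x = x < fromℚ (+ a ℚ./ b)

OppositeSides : ℝ → (a b p q : ℕ) → Set
OppositeSides x a b p q =
  (FractionBelow a b x × FractionAbove p q x) ⊎
  (FractionAbove a b x × FractionBelow p q x)

{-# OPTIONS --safe #-}
module Submission where

-- Identify i + jθ with the lattice point (i , j), so that S(θ) is the quadrant ℕ² ordered by
-- the linear form x + yθ.  Let x, y = x + U, z = x + U + V be consecutive.  If U and V lie on
-- the same side of θ then x + V is in the quadrant, and it falls into one of the two gaps.  If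
-- they lie on opposite sides and the determinant D of (U , V) is at least 2, then some lattice
-- point reduced modulo U and V gives a further point of the triangle x y z, which again falls
-- into a gap.  Conversely, if D = 1 then U and V form a lattice basis; put y on an axis at the
-- least distance that keeps y - U and y + V in the quadrant.  Expanding a point of a gap in
-- this basis forces one of its coordinates to be negative, except in degenerate cases that
-- are settled by the fact that no difference exceeds 1.

open import Defs
open import Data.Empty using (⊥; ⊥-elim)
open import Data.Integer.Base as ℤ using (ℤ; +_; -[1+_]; +[1+_]; 0ℤ; 1ℤ; -1ℤ)
import Data.Integer.DivMod as ℤ
import Data.Integer.Properties as ℤ
open import Data.Integer.Tactic.RingSolver using (solve-∀)
open import Data.List.Base using (_∷_; [])
import Data.List.Properties as List
open import Data.Nat.Base as ℕ using (ℕ; zero; suc)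
import Data.Nat.Properties as ℕ
open import Data.Product.Base using (_×_; _,_; ∃; ∃₂; proj₁; proj₂; swap)
open import Data.Rational.Base as ℚ using (ℚ; 0ℚ; 1ℚ; ½)
import Data.Rational.Properties as ℚ
open import Data.Rational.Solver using (module +-*-Solver)
open import Data.Rational.Unnormalised.Base as ℚᵘ using (mkℚᵘ; *≡*)
import Data.Rational.Unnormalised.Properties as ℚᵘ
open import Data.Sum.Base using (_⊎_; inj₁; inj₂)
open import Function.Bundles using (_⇔_; mk⇔)
open import Level using (0ℓ)
open import Relation.Binary.Definitions using (tri<; tri≈; tri>)
open import Relation.Binary.PropositionalEquality
  using (_≡_; _≢_; refl; sym; trans; cong; cong₂; subst; subst₂)
open import Relation.Nullary.Negation using (¬_)
open import Relation.Unary using (Pred)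

-- The word `10` is excepted because the criterion fails for it. Its values are `θ - 1` and `1`, and
-- `1/1 < θ < 1/0` with determinant 1, yet a gap of length 1 occurs only from 0 to 1: for every
-- other point `x` of the quadrant, `x + θ - 1` or `x + 2 - θ` is again in the quadrant and cuts the
-- unit gap. In the converse the exception surfaces as the case `q = 0` of `below-above⇒corner`. The
-- geometry is done for an arbitrary positive cone on the lattice, a notion symmetric in the two
-- axes, so that `U` below θ reduces to `U` above θ by reflection in the diagonal. The assumptions
-- `1 < θ < 2` break the symmetry; they enter the geometry as `P (-1ℤ , 1ℤ)` and `P (+ 2 , -1ℤ)`.

-- Integer inequalities as nonnegativity statements

0≤-+ : ∀ {i j} → 0ℤ ℤ.≤ i → 0ℤ ℤ.≤ j → 0ℤ ℤ.≤ i ℤ.+ j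
0≤-+ = ℤ.+-mono-≤

0≤-* : ∀ {i j} → 0ℤ ℤ.≤ i → 0ℤ ℤ.≤ j → 0ℤ ℤ.≤ i ℤ.* j
0≤-* {+ m} {+ n} _ _ = subst (0ℤ ℤ.≤_) (ℤ.pos-* m n) (ℤ.+≤+ ℕ.z≤n)

0≤-cancel-* : ∀ i {j} → 0ℤ ℤ.≤ i ℤ.- 1ℤ → 0ℤ ℤ.≤ i ℤ.* j → 0ℤ ℤ.≤ j
0≤-cancel-* +[1+ m ] {j} _ 0≤ij =
  ℤ.*-cancelˡ-≤-pos 0ℤ j +[1+ m ] (subst (ℤ._≤ +[1+ m ] ℤ.* j) (sym (ℤ.*-zeroʳ +[1+ m ])) 0≤ij)

0≤-pred : ∀ i → 0ℤ ℤ.≤ i ℤ.- 1ℤ → 0ℤ ℤ.≤ i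
0≤-pred (+ _) _ = ℤ.+≤+ ℕ.z≤n

0≤-neg-neg : ∀ {i} → 0ℤ ℤ.≤ i → 0ℤ ℤ.≤ ℤ.- (ℤ.- i)
0≤-neg-neg {i} 0≤i = subst (0ℤ ℤ.≤_) (sym (ℤ.neg-involutive i)) 0≤i

-- Applied to `i - 1`, it separates `1 ≤ i` from `i ≤ 0`, the latter in the form `0 ≤ -1 - (i - 1)`.
0≤i-or-i<0 : ∀ i → 0ℤ ℤ.≤ i ⊎ 0ℤ ℤ.≤ -1ℤ ℤ.- i
0≤i-or-i<0 (+ n)    = inj₁ (ℤ.+≤+ ℕ.z≤n)
0≤i-or-i<0 -[1+ n ] = inj₂ (ℤ.+≤+ ℕ.z≤n)

-- Inequalities are kept in the form `0 ≤ e` so that an impossible set of them is refuted by a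
-- certificate: a combination of nonnegative terms, often called `slack`, that adds up to -1 by a
-- ring identity.
0≤-sum≢-1 : ∀ {i j} → 0ℤ ℤ.≤ i → 0ℤ ℤ.≤ j → i ℤ.+ j ≢ -1ℤ
0≤-sum≢-1 {+ _} {+ _} _ _ ()

0≤∧<1⇒≡0 : ∀ {i} → 0ℤ ℤ.≤ i → 0ℤ ℤ.≤ -1ℤ ℤ.- (i ℤ.- 1ℤ) → i ≡ 0ℤ
0≤∧<1⇒≡0 {+ zero}  _ _ = refl
0≤∧<1⇒≡0 {+[1+ zero ]} _ ()
0≤∧<1⇒≡0 {+[1+ suc _ ]} _ ()

-- Positive cones on ℤ²

Point : Set
Point = ℤ × ℤ

infixl 6 _⊕_ _⊝_
infixl 7 _•_

_⊕_ _⊝_ : Point → Point → Point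
(a , b) ⊕ (c , d) = a ℤ.+ c , b ℤ.+ d
(a , b) ⊝ (c , d) = a ℤ.- c , b ℤ.- d

_•_ : ℤ → Point → Point
k • (a , b) = k ℤ.* a , k ℤ.* b

⊖_ : Point → Point
⊖ (a , b) = ℤ.- a , ℤ.- b

𝟘 : Point
𝟘 = 0ℤ , 0ℤ

Quadrant : Pred Point 0ℓ
Quadrant (a , b) = 0ℤ ℤ.≤ a × 0ℤ ℤ.≤ b

⊝≡𝟘⇒≡ : ∀ x y → x ⊝ y ≡ 𝟘 → x ≡ y
⊝≡𝟘⇒≡ (a , b) (c , d) eq =
  cong₂ _,_ (ℤ.i-j≡0⇒i≡j a c (cong proj₁ eq)) (ℤ.i-j≡0⇒i≡j b d (cong proj₂ eq))

-- `P (a , b)` stands for `a + bθ > 0`. These are the axioms of a total order on the lattice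
-- compatible with addition, in which both unit vectors are positive.
record IsPositiveCone (P : Pred Point 0ℓ) : Set where
  field
    ⊕-closed   : ∀ {x y} → P x → P y → P (x ⊕ y)
    trichotomy : ∀ x → x ≡ 𝟘 ⊎ P x ⊎ P (⊖ x)
    ¬P𝟘        : ¬ P 𝟘
    P-e₁       : P (1ℤ , 0ℤ)
    P-e₂       : P (0ℤ , 1ℤ)

-- Reflection in the diagonal; up to a positive factor it replaces θ by `1/θ`.
swap-cone : ∀ {P} → IsPositiveCone P → IsPositiveCone (λ x → P (swap x))
swap-cone {P} cone = record
  { ⊕-closed   = ⊕-closed
  ; trichotomy = λ x → swap-tri x (trichotomy (swap x))
  ; ¬P𝟘        = ¬P𝟘
  ; P-e₁       = P-e₂
  ; P-e₂       = P-e₁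
  }
  where
  open IsPositiveCone cone
  swap-tri : ∀ x → swap x ≡ 𝟘 ⊎ P (swap x) ⊎ P (⊖ swap x) → x ≡ 𝟘 ⊎ P (swap x) ⊎ P (swap (⊖ x))
  swap-tri x (inj₁ eq) = inj₁ (cong swap eq)
  swap-tri x (inj₂ r)  = inj₂ r

-- Membership of the two end points in the quadrant is carried separately.
Consecutive : Pred Point 0ℓ → Point → Point → Set
Consecutive P x y = P (y ⊝ x) × (∀ w → Quadrant w → P (w ⊝ x) → ¬ P (y ⊝ w))

swap-Consecutive : ∀ {P x y} → Consecutive (λ v → P (swap v)) x y → Consecutive P (swap x) (swap y)
swap-Consecutive (pos , gap) = pos , λ w (0≤a , 0≤b) → gap (swap w) (0≤b , 0≤a)

module Cone {P : Pred Point 0ℓ} (cone : IsPositiveCone P) where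
  open IsPositiveCone cone

  P-• : ∀ k {x} → 0ℤ ℤ.≤ k ℤ.- 1ℤ → P x → P (k • x)
  P-• +[1+ n ] {x} _ Px = go n
    where
    step : ∀ k x → x ⊕ k • x ≡ (1ℤ ℤ.+ k) • x
    step k (a , b) = cong₂ _,_ (lem k a) (lem k b)
      where
      lem : ∀ k a → a ℤ.+ k ℤ.* a ≡ (1ℤ ℤ.+ k) ℤ.* a
      lem = solve-∀
    go : ∀ n → P (+[1+ n ] • x)
    go zero    = subst P (sym (cong₂ _,_ (ℤ.*-identityˡ _) (ℤ.*-identityˡ _))) Px
    go (suc n) = subst P (step +[1+ n ] x) (⊕-closed Px (go n))

  P-comb : ∀ α β {x y} → 0ℤ ℤ.≤ α → 0ℤ ℤ.≤ β → 0ℤ ℤ.≤ α ℤ.+ β ℤ.- 1ℤ →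
    P x → P y → P (α • x ⊕ β • y)
  P-comb +[1+ m ] +[1+ n ] _ _ _ Px Py =
    ⊕-closed (P-• +[1+ m ] (ℤ.+≤+ ℕ.z≤n) Px) (P-• +[1+ n ] (ℤ.+≤+ ℕ.z≤n) Py)
  P-comb +[1+ m ] (+ zero) _ _ _ Px _ =
    subst P (cong₂ _,_ (sym (ℤ.+-identityʳ _)) (sym (ℤ.+-identityʳ _))) (P-• +[1+ m ] (ℤ.+≤+ ℕ.z≤n) Px)
  P-comb (+ zero) +[1+ n ] _ _ _ _ Py =
    subst P (cong₂ _,_ (sym (ℤ.+-identityˡ _)) (sym (ℤ.+-identityˡ _))) (P-• +[1+ n ] (ℤ.+≤+ ℕ.z≤n) Py)
  P-comb (+ zero) (+ zero) _ _ () _ _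

  P⇒¬P⊖ : ∀ {x} → P x → ¬ P (⊖ x)
  P⇒¬P⊖ {a , b} Px P⊖x =
    ¬P𝟘 (subst P (cong₂ _,_ (ℤ.+-inverseʳ a) (ℤ.+-inverseʳ b)) (⊕-closed Px P⊖x))

  -- If both coefficients vanish then `w` is `𝟘`; otherwise `P-comb` makes `⊖ w` positive.
  ¬P-neg-comb : ∀ α β {x y w} → 0ℤ ℤ.≤ α → 0ℤ ℤ.≤ β → P x → P y →
    w ≡ (ℤ.- α) • x ⊕ (ℤ.- β) • y → ¬ P w
  ¬P-neg-comb α β {a , b} {c , d} 0≤α 0≤β Px Py refl Pw with 0≤i-or-i<0 (α ℤ.+ β ℤ.- 1ℤ)
  ... | inj₁ 1≤α+β = P⇒¬P⊖ (P-comb α β 0≤α 0≤β 1≤α+β Px Py)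
    (subst P (cong₂ _,_ (neg-comb α β a c) (neg-comb α β b d)) Pw)
    where
    neg-comb : ∀ α β a c → (ℤ.- α) ℤ.* a ℤ.+ (ℤ.- β) ℤ.* c ≡ ℤ.- (α ℤ.* a ℤ.+ β ℤ.* c)
    neg-comb = solve-∀
  ... | inj₂ α+β<1 with 0≤i-or-i<0 (α ℤ.- 1ℤ) | 0≤i-or-i<0 (β ℤ.- 1ℤ)
  ...   | inj₁ 1≤α | _ = 0≤-sum≢-1 1≤α (0≤-+ 0≤β α+β<1) (e α β)
    where
    e : ∀ α β → α ℤ.- 1ℤ ℤ.+ (β ℤ.+ (-1ℤ ℤ.- (α ℤ.+ β ℤ.- 1ℤ))) ≡ -1ℤ
    e = solve-∀
  ...   | _ | inj₁ 1≤β = 0≤-sum≢-1 1≤β (0≤-+ 0≤α α+β<1) (e α β)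
    where
    e : ∀ α β → β ℤ.- 1ℤ ℤ.+ (α ℤ.+ (-1ℤ ℤ.- (α ℤ.+ β ℤ.- 1ℤ))) ≡ -1ℤ
    e = solve-∀
  ...   | inj₂ α<1 | inj₂ β<1 with 0≤∧<1⇒≡0 0≤α α<1 | 0≤∧<1⇒≡0 0≤β β<1
  ...     | refl | refl = ¬P𝟘 Pw

  P-cancel-• : ∀ k {x} → 0ℤ ℤ.≤ k ℤ.- 1ℤ → P (k • x) → P x
  P-cancel-• k {x@(a , b)} 1≤k Pkx with trichotomy x
  ... | inj₁ refl = ⊥-elim (¬P𝟘 (subst P (cong₂ _,_ (ℤ.*-zeroʳ k) (ℤ.*-zeroʳ k)) Pkx))
  ... | inj₂ (inj₁ Px) = Px
  ... | inj₂ (inj₂ P⊖x) = ⊥-elim (P⇒¬P⊖ Pkx (subst P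
    (cong₂ _,_ (sym (ℤ.neg-distribʳ-* k a)) (sym (ℤ.neg-distribʳ-* k b))) (P-• k 1≤k P⊖x)))

  quadrant⇒¬P⊖ : ∀ x → Quadrant x → ¬ P (𝟘 ⊝ x)
  quadrant⇒¬P⊖ (a , b) (0≤a , 0≤b) =
    ¬P-neg-comb a b 0≤a 0≤b P-e₁ P-e₂ (cong₂ _,_ (on-e₁ a b) (on-e₂ a b))
    where
    on-e₁ : ∀ a b → 0ℤ ℤ.- a ≡ (ℤ.- a) ℤ.* 1ℤ ℤ.+ (ℤ.- b) ℤ.* 0ℤ
    on-e₁ = solve-∀
    on-e₂ : ∀ a b → 0ℤ ℤ.- b ≡ (ℤ.- a) ℤ.* 0ℤ ℤ.+ (ℤ.- b) ℤ.* 1ℤ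
    on-e₂ = solve-∀

  P⇒1≤fst : ∀ {a b} → 0ℤ ℤ.≤ ℤ.- b → P (a , b) → 0ℤ ℤ.≤ a ℤ.- 1ℤ
  P⇒1≤fst {a} {b} b≤0 Pab with 0≤i-or-i<0 (a ℤ.- 1ℤ)
  ... | inj₁ 1≤a = 1≤a
  ... | inj₂ a<1 = ⊥-elim (quadrant⇒¬P⊖ (-1ℤ ℤ.- (a ℤ.- 1ℤ) , ℤ.- b) (a<1 , b≤0)
    (subst P (cong₂ _,_ (e₁ a) (e₂ b)) Pab))
    where
    e₁ : ∀ a → a ≡ 0ℤ ℤ.- (-1ℤ ℤ.- (a ℤ.- 1ℤ))
    e₁ = solve-∀
    e₂ : ∀ b → b ≡ 0ℤ ℤ.- (ℤ.- b)
    e₂ = solve-∀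

  P⇒1≤snd : ∀ {a b} → 0ℤ ℤ.≤ ℤ.- a → P (a , b) → 0ℤ ℤ.≤ b ℤ.- 1ℤ
  P⇒1≤snd {a} {b} a≤0 Pab with 0≤i-or-i<0 (b ℤ.- 1ℤ)
  ... | inj₁ 1≤b = 1≤b
  ... | inj₂ b<1 = ⊥-elim (quadrant⇒¬P⊖ (ℤ.- a , -1ℤ ℤ.- (b ℤ.- 1ℤ)) (a≤0 , b<1)
    (subst P (cong₂ _,_ (e₂ a) (e₁ b)) Pab))
    where
    e₁ : ∀ a → a ≡ 0ℤ ℤ.- (-1ℤ ℤ.- (a ℤ.- 1ℤ))
    e₁ = solve-∀
    e₂ : ∀ b → b ≡ 0ℤ ℤ.- (ℤ.- b)
    e₂ = solve-∀

  ¬P[-,0] : ∀ a → ¬ P (ℤ.- (+ a) , 0ℤ)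
  ¬P[-,0] a pos = quadrant⇒¬P⊖ (+ a , 0ℤ) (ℤ.+≤+ ℕ.z≤n , ℤ.≤-refl)
    (subst (λ i → P (i , 0ℤ)) (sym (ℤ.+-identityˡ (ℤ.- (+ a)))) pos)

  P-opposite : ∀ a b → P (a , ℤ.- b) → ¬ P (ℤ.- a , b)
  P-opposite a b pos neg = P⇒¬P⊖ pos
    (subst (λ i → P (ℤ.- a , i)) (sym (ℤ.neg-involutive b)) neg)

  -- The positive combination `q • U ⊕ B • V` lies on the horizontal axis, and its first coordinate
  -- is the determinant.
  1≤determinant : ∀ A B p q → 0ℤ ℤ.≤ B → 0ℤ ℤ.≤ q ℤ.- 1ℤ → P (A , ℤ.- B) → P (ℤ.- p , q) →
    0ℤ ℤ.≤ A ℤ.* q ℤ.- B ℤ.* p ℤ.- 1ℤ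
  1≤determinant A B p q 0≤B 1≤q PU PV = P⇒1≤fst ℤ.≤-refl
    (subst P (cong₂ _,_ (fst A B p q) (snd B q))
      (P-comb q B (0≤-pred q 1≤q) 0≤B (subst (0ℤ ℤ.≤_) (q-1+B q B) (0≤-+ 1≤q 0≤B)) PU PV))
    where
    fst : ∀ A B p q → q ℤ.* A ℤ.+ B ℤ.* (ℤ.- p) ≡ A ℤ.* q ℤ.- B ℤ.* p
    fst = solve-∀
    snd : ∀ B q → q ℤ.* (ℤ.- B) ℤ.+ B ℤ.* q ≡ 0ℤ
    snd = solve-∀
    q-1+B : ∀ q B → q ℤ.- 1ℤ ℤ.+ B ≡ q ℤ.+ B ℤ.- 1ℤ
    q-1+B = solve-∀

  -- If V could be taken first, the shorter of U and V would fall into the gap of the other.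
  same-side : ∀ {x U V} → Consecutive P x (x ⊕ U) → Consecutive P (x ⊕ U) (x ⊕ U ⊕ V) →
    Quadrant (x ⊕ V) → U ≡ V
  same-side {x@(x₁ , x₂)} {U@(a , b)} {V@(c , d)} (PU , gap₁) (PV , gap₂) quad
    with trichotomy (U ⊝ V)
  ... | inj₁ eq = ⊝≡𝟘⇒≡ U V eq
  ... | inj₂ (inj₁ V<U) = ⊥-elim (gap₁ (x ⊕ V) quad
    (subst P (cong₂ _,_ (e₁ x₁ a c) (e₁ x₂ b d)) PV)
    (subst P (cong₂ _,_ (e₂ x₁ a c) (e₂ x₂ b d)) V<U))
    where
    e₁ : ∀ x u v → x ℤ.+ u ℤ.+ v ℤ.- (x ℤ.+ u) ≡ x ℤ.+ v ℤ.- x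
    e₁ = solve-∀
    e₂ : ∀ x u v → u ℤ.- v ≡ x ℤ.+ u ℤ.- (x ℤ.+ v)
    e₂ = solve-∀
  ... | inj₂ (inj₂ U<V) = ⊥-elim (gap₂ (x ⊕ V) quad
    (subst P (cong₂ _,_ (e₁ x₁ a c) (e₁ x₂ b d)) U<V)
    (subst P (cong₂ _,_ (e₂ x₁ a c) (e₂ x₂ b d)) PU))
    where
    e₁ : ∀ x u v → ℤ.- (u ℤ.- v) ≡ x ℤ.+ v ℤ.- (x ℤ.+ u)
    e₁ = solve-∀
    e₂ : ∀ x u v → x ℤ.+ u ℤ.- x ≡ x ℤ.+ u ℤ.+ v ℤ.- (x ℤ.+ v)
    e₂ = solve-∀

-- Determinant 1: two consecutive gaps around a point of an axis

module Realisation {P : Pred Point 0ℓ} (cone : IsPositiveCone P) where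
  open IsPositiveCone cone
  open Cone cone

  module _
    (A B p q : ℤ) (1≤A : 0ℤ ℤ.≤ A ℤ.- 1ℤ) (0≤B : 0ℤ ℤ.≤ B)
    (1≤p : 0ℤ ℤ.≤ p ℤ.- 1ℤ) (1≤q : 0ℤ ℤ.≤ q ℤ.- 1ℤ)
    (PU : P (A , ℤ.- B)) (PV : P (ℤ.- p , q)) (det : A ℤ.* q ℤ.- B ℤ.* p ≡ 1ℤ)
    -- For `B = 0` the point `y ⊕ U` stays on the axis, hence in the quadrant, and must not fall
    -- before `y ⊕ V`.
    (V<U : B ≡ 0ℤ → P ((A , ℤ.- B) ⊝ (ℤ.- p , q)))
    -- The middle point is `y = (M , 0)`. The first two bounds keep `y ⊝ U` and `y ⊕ V` in the
    -- quadrant; the third makes the first coordinate of `y ⊝ m • U ⊕ n • V` negative as soon as `m`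
    -- and `n` are both at least 1.
    (M : ℤ) (A≤M : 0ℤ ℤ.≤ M ℤ.- A) (p≤M : 0ℤ ℤ.≤ M ℤ.- p)
    (M<A+p : 0ℤ ℤ.≤ A ℤ.+ p ℤ.- 1ℤ ℤ.- M)
    where

    private
      U V y : Point
      U = A , ℤ.- B
      V = ℤ.- p , q
      y = M , 0ℤ

    -- Cramer's rule. The determinant is 1, so the coefficients are integers, and `U` and `V` form a
    -- basis of the lattice.
    coordinates : ∀ a b → ∃₂ λ m n →
      a ≡ m ℤ.* A ℤ.+ n ℤ.* (ℤ.- p) × b ≡ m ℤ.* (ℤ.- B) ℤ.+ n ℤ.* q
    coordinates a b =
      q ℤ.* a ℤ.+ p ℤ.* b , B ℤ.* a ℤ.+ A ℤ.* b ,
      trans (scale a) (e₁ A B p q a b) , trans (scale b) (e₂ A B p q a b)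
      where
      scale : ∀ c → c ≡ (A ℤ.* q ℤ.- B ℤ.* p) ℤ.* c
      scale c = trans (sym (ℤ.*-identityˡ c)) (cong (ℤ._* c) (sym det))
      e₁ : ∀ A B p q a b → (A ℤ.* q ℤ.- B ℤ.* p) ℤ.* a ≡
        (q ℤ.* a ℤ.+ p ℤ.* b) ℤ.* A ℤ.+ (B ℤ.* a ℤ.+ A ℤ.* b) ℤ.* (ℤ.- p)
      e₁ = solve-∀
      e₂ : ∀ A B p q a b → (A ℤ.* q ℤ.- B ℤ.* p) ℤ.* b ≡
        (q ℤ.* a ℤ.+ p ℤ.* b) ℤ.* (ℤ.- B) ℤ.+ (B ℤ.* a ℤ.+ A ℤ.* b) ℤ.* q
      e₂ = solve-∀

    -- Write `y ⊝ w = m • U ⊕ n • V`. If `m, n ≤ 0`, then `w` is not before `y`; if `m ≥ 1` and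
    -- `n ≥ 0`, it is not after `y ⊝ U`. The mixed signs leave the quadrant: `m ≤ 0 < n` makes the
    -- second coordinate of `w` at most `-q`, and `n < 0 < m` makes the first at most `M - A - p`.
    gap-before : ∀ w → Quadrant w → P (w ⊝ (y ⊝ U)) → ¬ P (y ⊝ w)
    gap-before (k , l) (0≤k , 0≤l) P₁ P₂ =
      let m , n , eq₁ , eq₂ = coordinates (M ℤ.- k) (0ℤ ℤ.- l) in go m n eq₁ eq₂
      where
      go : ∀ m n → M ℤ.- k ≡ m ℤ.* A ℤ.+ n ℤ.* (ℤ.- p) →
        0ℤ ℤ.- l ≡ m ℤ.* (ℤ.- B) ℤ.+ n ℤ.* q → ⊥
      go m n eq₁ eq₂ with 0≤i-or-i<0 (m ℤ.- 1ℤ) | 0≤i-or-i<0 (n ℤ.- 1ℤ) | 0≤i-or-i<0 n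
      ... | inj₂ m≤0 | inj₂ n≤0 | _ =
        ¬P-neg-comb (-1ℤ ℤ.- (m ℤ.- 1ℤ)) (-1ℤ ℤ.- (n ℤ.- 1ℤ)) m≤0 n≤0 PU PV
          (cong₂ _,_ (trans eq₁ (e m n A (ℤ.- p))) (trans eq₂ (e m n (ℤ.- B) q))) P₂
        where
        e : ∀ m n a b → m ℤ.* a ℤ.+ n ℤ.* b ≡
          (ℤ.- (-1ℤ ℤ.- (m ℤ.- 1ℤ))) ℤ.* a ℤ.+ (ℤ.- (-1ℤ ℤ.- (n ℤ.- 1ℤ))) ℤ.* b
        e = solve-∀
      ... | inj₂ m≤0 | inj₁ 1≤n | _ =
        0≤-sum≢-1 0≤l (0≤-+ (0≤-+ (0≤-* m≤0 0≤B) (0≤-* 1≤n (0≤-pred q 1≤q))) 1≤q)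
          (trans (e₁ l _) (trans (cong (λ t → slack ℤ.- t) eq₂) (e₂ m n B q)))
        where
        slack : ℤ
        slack = (-1ℤ ℤ.- (m ℤ.- 1ℤ)) ℤ.* B ℤ.+ (n ℤ.- 1ℤ) ℤ.* q ℤ.+ (q ℤ.- 1ℤ)
        e₁ : ∀ l slack → l ℤ.+ slack ≡ slack ℤ.- (0ℤ ℤ.- l)
        e₁ = solve-∀
        e₂ : ∀ m n B q →
          (-1ℤ ℤ.- (m ℤ.- 1ℤ)) ℤ.* B ℤ.+ (n ℤ.- 1ℤ) ℤ.* q ℤ.+ (q ℤ.- 1ℤ)
            ℤ.- (m ℤ.* (ℤ.- B) ℤ.+ n ℤ.* q) ≡ -1ℤ
        e₂ = solve-∀
      ... | inj₁ 1≤m | _ | inj₁ 0≤n =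
        ¬P-neg-comb (m ℤ.- 1ℤ) n 1≤m 0≤n PU PV
          (cong₂ _,_
            (trans (e₁ k M A) (trans (cong (λ t → A ℤ.- t) eq₁) (e₂ m n A (ℤ.- p))))
            (trans (e₁ l 0ℤ (ℤ.- B)) (trans (cong (λ t → ℤ.- B ℤ.- t) eq₂) (e₂ m n (ℤ.- B) q)))) P₁
        where
        e₁ : ∀ k M a → k ℤ.- (M ℤ.- a) ≡ a ℤ.- (M ℤ.- k)
        e₁ = solve-∀
        e₂ : ∀ m n a b → a ℤ.- (m ℤ.* a ℤ.+ n ℤ.* b) ≡
          (ℤ.- (m ℤ.- 1ℤ)) ℤ.* a ℤ.+ (ℤ.- n) ℤ.* b
        e₂ = solve-∀
      ... | inj₁ 1≤m | _ | inj₂ n<0 =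
        0≤-sum≢-1 0≤k (0≤-+ (0≤-+ (0≤-* 1≤m (0≤-pred A 1≤A)) (0≤-* n<0 (0≤-pred p 1≤p))) M<A+p)
          (trans (e₁ k M _) (trans (cong (λ t → M ℤ.+ slack ℤ.- t) eq₁) (e₂ m n A p M)))
        where
        slack : ℤ
        slack = (m ℤ.- 1ℤ) ℤ.* A ℤ.+ (-1ℤ ℤ.- n) ℤ.* p ℤ.+ (A ℤ.+ p ℤ.- 1ℤ ℤ.- M)
        e₁ : ∀ k M slack → k ℤ.+ slack ≡ M ℤ.+ slack ℤ.- (M ℤ.- k)
        e₁ = solve-∀
        e₂ : ∀ m n A p M →
          M ℤ.+ ((m ℤ.- 1ℤ) ℤ.* A ℤ.+ (-1ℤ ℤ.- n) ℤ.* p ℤ.+ (A ℤ.+ p ℤ.- 1ℤ ℤ.- M))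
            ℤ.- (m ℤ.* A ℤ.+ n ℤ.* (ℤ.- p)) ≡ -1ℤ
        e₂ = solve-∀

    -- The same analysis for `w ⊝ y = m • U ⊕ n • V`, except that `m ≥ 1` with `n = 0` is not
    -- settled by signs alone when `B = 0`.
    gap-after : ∀ w → Quadrant w → P (w ⊝ y) → ¬ P (y ⊕ V ⊝ w)
    gap-after (k , l) (0≤k , 0≤l) P₁ P₂ =
      let m , n , eq₁ , eq₂ = coordinates (k ℤ.- M) (l ℤ.- 0ℤ) in go m n eq₁ eq₂
      where
      go : ∀ m n → k ℤ.- M ≡ m ℤ.* A ℤ.+ n ℤ.* (ℤ.- p) →
        l ℤ.- 0ℤ ≡ m ℤ.* (ℤ.- B) ℤ.+ n ℤ.* q → ⊥
      go m n eq₁ eq₂ with 0≤i-or-i<0 (n ℤ.- 1ℤ) | 0≤i-or-i<0 m | 0≤i-or-i<0 (m ℤ.- 1ℤ) | 0≤i-or-i<0 n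
      ... | inj₁ 1≤n | inj₁ 0≤m | _ | _ =
        ¬P-neg-comb m (n ℤ.- 1ℤ) 0≤m 1≤n PU PV
          (cong₂ _,_
            (trans (e₁ M (ℤ.- p) k) (trans (cong (λ t → ℤ.- p ℤ.- t) eq₁) (e₂ m n A (ℤ.- p))))
            (trans (e₁ 0ℤ q l) (trans (cong (λ t → q ℤ.- t) eq₂) (e₂ m n (ℤ.- B) q)))) P₂
        where
        e₁ : ∀ M v k → M ℤ.+ v ℤ.- k ≡ v ℤ.- (k ℤ.- M)
        e₁ = solve-∀
        e₂ : ∀ m n a b → b ℤ.- (m ℤ.* a ℤ.+ n ℤ.* b) ≡
          (ℤ.- m) ℤ.* a ℤ.+ (ℤ.- (n ℤ.- 1ℤ)) ℤ.* b
        e₂ = solve-∀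
      ... | inj₁ 1≤n | inj₂ m<0 | _ | _ =
        0≤-sum≢-1 0≤k (0≤-+ (0≤-+ (0≤-* m<0 (0≤-pred A 1≤A)) (0≤-* 1≤n (0≤-pred p 1≤p))) M<A+p)
          (trans (e₁ k M _) (trans (cong (λ t → t ℤ.+ M ℤ.+ slack) eq₁) (e₂ m n A p M)))
        where
        slack : ℤ
        slack = (-1ℤ ℤ.- m) ℤ.* A ℤ.+ (n ℤ.- 1ℤ) ℤ.* p ℤ.+ (A ℤ.+ p ℤ.- 1ℤ ℤ.- M)
        e₁ : ∀ k M slack → k ℤ.+ slack ≡ k ℤ.- M ℤ.+ M ℤ.+ slack
        e₁ = solve-∀
        e₂ : ∀ m n A p M →
          m ℤ.* A ℤ.+ n ℤ.* (ℤ.- p) ℤ.+ M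
            ℤ.+ ((-1ℤ ℤ.- m) ℤ.* A ℤ.+ (n ℤ.- 1ℤ) ℤ.* p ℤ.+ (A ℤ.+ p ℤ.- 1ℤ ℤ.- M)) ≡ -1ℤ
        e₂ = solve-∀
      ... | inj₂ n≤0 | _ | inj₂ m≤0 | _ =
        ¬P-neg-comb (-1ℤ ℤ.- (m ℤ.- 1ℤ)) (-1ℤ ℤ.- (n ℤ.- 1ℤ)) m≤0 n≤0 PU PV
          (cong₂ _,_ (trans eq₁ (e m n A (ℤ.- p))) (trans eq₂ (e m n (ℤ.- B) q))) P₁
        where
        e : ∀ m n a b → m ℤ.* a ℤ.+ n ℤ.* b ≡
          (ℤ.- (-1ℤ ℤ.- (m ℤ.- 1ℤ))) ℤ.* a ℤ.+ (ℤ.- (-1ℤ ℤ.- (n ℤ.- 1ℤ))) ℤ.* b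
        e = solve-∀
      ... | inj₂ n≤0 | _ | inj₁ 1≤m | inj₂ n<0 =
        0≤-sum≢-1 0≤l (0≤-+ (0≤-+ (0≤-* (0≤-pred m 1≤m) 0≤B) (0≤-* n<0 (0≤-pred q 1≤q))) 1≤q)
          (trans (e₁ l _) (trans (cong (ℤ._+ slack) eq₂) (e₂ m n B q)))
        where
        slack : ℤ
        slack = m ℤ.* B ℤ.+ (-1ℤ ℤ.- n) ℤ.* q ℤ.+ (q ℤ.- 1ℤ)
        e₁ : ∀ l slack → l ℤ.+ slack ≡ l ℤ.- 0ℤ ℤ.+ slack
        e₁ = solve-∀
        e₂ : ∀ m n B q → m ℤ.* (ℤ.- B) ℤ.+ n ℤ.* q
            ℤ.+ (m ℤ.* B ℤ.+ (-1ℤ ℤ.- n) ℤ.* q ℤ.+ (q ℤ.- 1ℤ)) ≡ -1ℤ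
        e₂ = solve-∀
      -- Here `n = 0`, so the second coordinate of `w` is `- m * B`, which is negative unless
      -- `B = 0`.
      ... | inj₂ n≤0 | _ | inj₁ 1≤m | inj₁ 0≤n with 0≤i-or-i<0 (B ℤ.- 1ℤ)
      ...   | inj₁ 1≤B =
        0≤-sum≢-1 0≤l (0≤-+ (0≤-+ (0≤-* 1≤m 0≤B) (0≤-* n≤0 (0≤-pred q 1≤q))) 1≤B)
          (trans (e₁ l _) (trans (cong (ℤ._+ slack) eq₂) (e₂ m n B q)))
        where
        slack : ℤ
        slack = (m ℤ.- 1ℤ) ℤ.* B ℤ.+ (-1ℤ ℤ.- (n ℤ.- 1ℤ)) ℤ.* q ℤ.+ (B ℤ.- 1ℤ)
        e₁ : ∀ l slack → l ℤ.+ slack ≡ l ℤ.- 0ℤ ℤ.+ slack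
        e₁ = solve-∀
        e₂ : ∀ m n B q → m ℤ.* (ℤ.- B) ℤ.+ n ℤ.* q
            ℤ.+ ((m ℤ.- 1ℤ) ℤ.* B ℤ.+ (-1ℤ ℤ.- (n ℤ.- 1ℤ)) ℤ.* q ℤ.+ (B ℤ.- 1ℤ)) ≡ -1ℤ
        e₂ = solve-∀
      -- `U` is horizontal and `w` does lie in the quadrant, but too far out. Adding the positive
      -- `U ⊝ V` to the positive `y ⊕ V ⊝ w` gives `U ⊝ (w ⊝ y)`, which is a nonpositive combination
      -- of `U` and `V`.
      ...   | inj₂ B≤0 =
        ¬P-neg-comb (m ℤ.- 1ℤ) n 1≤m 0≤n PU PV
          (cong₂ _,_
            (trans (e₁ M (ℤ.- p) k A) (trans (cong (λ t → A ℤ.- t) eq₁) (e₂ m n A (ℤ.- p))))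
            (trans (e₁ 0ℤ q l (ℤ.- B)) (trans (cong (λ t → ℤ.- B ℤ.- t) eq₂) (e₂ m n (ℤ.- B) q))))
          (⊕-closed P₂ (V<U (0≤∧<1⇒≡0 0≤B B≤0)))
        where
        e₁ : ∀ M v k u → M ℤ.+ v ℤ.- k ℤ.+ (u ℤ.- v) ≡ u ℤ.- (k ℤ.- M)
        e₁ = solve-∀
        e₂ : ∀ m n a b → a ℤ.- (m ℤ.* a ℤ.+ n ℤ.* b) ≡
          (ℤ.- (m ℤ.- 1ℤ)) ℤ.* a ℤ.+ (ℤ.- n) ℤ.* b
        e₂ = solve-∀

    opposite-steps : Quadrant (y ⊝ U) × Quadrant y × Quadrant (y ⊕ V) ×
      Consecutive P (y ⊝ U) y × Consecutive P y (y ⊕ V)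
    opposite-steps =
      (A≤M , subst (0ℤ ℤ.≤_) (e₁ B) 0≤B) ,
      (subst (0ℤ ℤ.≤_) (e₂ M p) (0≤-+ p≤M (0≤-pred p 1≤p)) , ℤ.+≤+ ℕ.z≤n) ,
      (p≤M , subst (0ℤ ℤ.≤_) (sym (ℤ.+-identityˡ q)) (0≤-pred q 1≤q)) ,
      (subst P (cong₂ _,_ (e₃ M A) (e₃ 0ℤ (ℤ.- B))) PU , gap-before) ,
      (subst P (cong₂ _,_ (e₄ M (ℤ.- p)) (e₄ 0ℤ q)) PV , gap-after)
      where
      e₁ : ∀ B → B ≡ 0ℤ ℤ.- (ℤ.- B)
      e₁ = solve-∀
      e₂ : ∀ M p → M ℤ.- p ℤ.+ p ≡ M
      e₂ = solve-∀
      e₃ : ∀ M a → a ≡ M ℤ.- (M ℤ.- a)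
      e₃ = solve-∀
      e₄ : ∀ M v → v ≡ M ℤ.+ v ℤ.- M
      e₄ = solve-∀

  -- The instance `U = 1`, `V = θ - 1`, `y = 1`. Here `B = 0`, and `V < U` is the inequality
  -- `θ < 2`.
  initial-steps : P (-1ℤ , 1ℤ) → P (+ 2 , -1ℤ) →
    Consecutive P 𝟘 (1ℤ , 0ℤ) × Consecutive P (1ℤ , 0ℤ) (0ℤ , 1ℤ)
  initial-steps P[-1,1] P[2,-1] =
    let _ , _ , _ , steps = opposite-steps 1ℤ 0ℤ 1ℤ 1ℤ ℤ.≤-refl ℤ.≤-refl ℤ.≤-refl ℤ.≤-refl
          P-e₁ P[-1,1] refl (λ _ → P[2,-1]) 1ℤ ℤ.≤-refl ℤ.≤-refl ℤ.≤-refl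
    in steps

-- Consecutive gaps on opposite sides have determinant 1

module Unimodularity {P : Pred Point 0ℓ} (cone : IsPositiveCone P) where
  open IsPositiveCone cone
  open Cone cone

  module _
    (A B p q : ℤ) (1≤A : 0ℤ ℤ.≤ A ℤ.- 1ℤ) (0≤B : 0ℤ ℤ.≤ B)
    (0≤p : 0ℤ ℤ.≤ p) (1≤q : 0ℤ ℤ.≤ q ℤ.- 1ℤ)
    (PU : P (A , ℤ.- B)) (PV : P (ℤ.- p , q))
    (x₁ x₂ : ℤ)
    (Qx : Quadrant (x₁ , x₂))
    (Qy : Quadrant ((x₁ , x₂) ⊕ (A , ℤ.- B)))
    (Qz : Quadrant ((x₁ , x₂) ⊕ (A , ℤ.- B) ⊕ (ℤ.- p , q)))
    (x→y : Consecutive P (x₁ , x₂) ((x₁ , x₂) ⊕ (A , ℤ.- B)))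
    (y→z : Consecutive P ((x₁ , x₂) ⊕ (A , ℤ.- B)) ((x₁ , x₂) ⊕ (A , ℤ.- B) ⊕ (ℤ.- p , q)))
    where

    private
      U V x y z : Point
      U = A , ℤ.- B
      V = ℤ.- p , q
      x = x₁ , x₂
      y = x ⊕ U
      z = x ⊕ U ⊕ V

      D : ℤ
      D = A ℤ.* q ℤ.- B ℤ.* p

    -- The integers `α`, `β`, `γ` are barycentric weights of `w`, left unnormalised to avoid
    -- fractions. The last three inequalities keep `w` off the vertices `x`, `z`, `y` in turn. By
    -- convexity `w` is in the quadrant and strictly between `x` and `z` in the order, so being
    -- different from `y` it falls into one of the two gaps.
    no-point-in-triangle : ∀ α β γ w →
      0ℤ ℤ.≤ α → 0ℤ ℤ.≤ β → 0ℤ ℤ.≤ γ →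
      0ℤ ℤ.≤ β ℤ.+ γ ℤ.- 1ℤ → 0ℤ ℤ.≤ α ℤ.+ β ℤ.- 1ℤ → 0ℤ ℤ.≤ α ℤ.+ γ ℤ.- 1ℤ →
      (α ℤ.+ β ℤ.+ γ) • w ≢ α • x ⊕ β • y ⊕ γ • z
    no-point-in-triangle α β γ w@(w₁ , w₂) 0≤α 0≤β 0≤γ x≢ z≢ y≢ eq = result (trichotomy (w ⊝ y))
      where
      k : ℤ
      k = α ℤ.+ β ℤ.+ γ

      1≤k : 0ℤ ℤ.≤ k ℤ.- 1ℤ
      1≤k = subst (0ℤ ℤ.≤_) (e α β γ) (0≤-+ 0≤α x≢)
        where
        e : ∀ α β γ → α ℤ.+ (β ℤ.+ γ ℤ.- 1ℤ) ≡ α ℤ.+ β ℤ.+ γ ℤ.- 1ℤ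
        e = solve-∀

      comb-nonneg : ∀ {a b c} → 0ℤ ℤ.≤ a → 0ℤ ℤ.≤ b → 0ℤ ℤ.≤ c →
        0ℤ ℤ.≤ α ℤ.* a ℤ.+ β ℤ.* b ℤ.+ γ ℤ.* c
      comb-nonneg 0≤a 0≤b 0≤c = 0≤-+ (0≤-+ (0≤-* 0≤α 0≤a) (0≤-* 0≤β 0≤b)) (0≤-* 0≤γ 0≤c)

      Qw : Quadrant w
      Qw =
        0≤-cancel-* k 1≤k (subst (0ℤ ℤ.≤_) (sym (cong proj₁ eq))
          (comb-nonneg (proj₁ Qx) (proj₁ Qy) (proj₁ Qz))) ,
        0≤-cancel-* k 1≤k (subst (0ℤ ℤ.≤_) (sym (cong proj₂ eq))
          (comb-nonneg (proj₂ Qx) (proj₂ Qy) (proj₂ Qz)))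

      x<w : P (w ⊝ x)
      x<w = P-cancel-• k 1≤k (subst P
        (cong₂ _,_ (e x₁ A (ℤ.- p) w₁ (cong proj₁ eq)) (e x₂ (ℤ.- B) q w₂ (cong proj₂ eq)))
        (P-comb β γ 0≤β 0≤γ x≢ PU (⊕-closed PU PV)))
        where
        e : ∀ x u v w → k ℤ.* w ≡ α ℤ.* x ℤ.+ β ℤ.* (x ℤ.+ u) ℤ.+ γ ℤ.* (x ℤ.+ u ℤ.+ v) →
          β ℤ.* u ℤ.+ γ ℤ.* (u ℤ.+ v) ≡ k ℤ.* (w ℤ.- x)
        e x u v w eq = trans (trans (e₁ α β γ x u v) (cong (λ t → t ℤ.- k ℤ.* x) (sym eq))) (e₂ k w x)
          where
          e₁ : ∀ α β γ x u v → β ℤ.* u ℤ.+ γ ℤ.* (u ℤ.+ v) ≡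
            α ℤ.* x ℤ.+ β ℤ.* (x ℤ.+ u) ℤ.+ γ ℤ.* (x ℤ.+ u ℤ.+ v) ℤ.- (α ℤ.+ β ℤ.+ γ) ℤ.* x
          e₁ = solve-∀
          e₂ : ∀ k w x → k ℤ.* w ℤ.- k ℤ.* x ≡ k ℤ.* (w ℤ.- x)
          e₂ = solve-∀

      w<z : P (z ⊝ w)
      w<z = P-cancel-• k 1≤k (subst P
        (cong₂ _,_ (e x₁ A (ℤ.- p) w₁ (cong proj₁ eq)) (e x₂ (ℤ.- B) q w₂ (cong proj₂ eq)))
        (P-comb α β 0≤α 0≤β z≢ (⊕-closed PU PV) PV))
        where
        e : ∀ x u v w → k ℤ.* w ≡ α ℤ.* x ℤ.+ β ℤ.* (x ℤ.+ u) ℤ.+ γ ℤ.* (x ℤ.+ u ℤ.+ v) →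
          α ℤ.* (u ℤ.+ v) ℤ.+ β ℤ.* v ≡ k ℤ.* (x ℤ.+ u ℤ.+ v ℤ.- w)
        e x u v w eq = trans
          (trans (e₁ α β γ x u v) (cong (λ t → k ℤ.* (x ℤ.+ u ℤ.+ v) ℤ.- t) (sym eq)))
          (e₂ k w (x ℤ.+ u ℤ.+ v))
          where
          e₁ : ∀ α β γ x u v → α ℤ.* (u ℤ.+ v) ℤ.+ β ℤ.* v ≡
            (α ℤ.+ β ℤ.+ γ) ℤ.* (x ℤ.+ u ℤ.+ v) ℤ.-
            (α ℤ.* x ℤ.+ β ℤ.* (x ℤ.+ u) ℤ.+ γ ℤ.* (x ℤ.+ u ℤ.+ v))
          e₁ = solve-∀
          e₂ : ∀ k w z → k ℤ.* z ℤ.- k ℤ.* w ≡ k ℤ.* (z ℤ.- w)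
          e₂ = solve-∀

      -- At `y` the weights balance, `γ • V = α • U`. The coordinates of `U` and `V` have opposite
      -- signs and `A, q ≥ 1`, so `α` and `γ` would both vanish.
      w≢y : w ≢ y
      w≢y refl = 0≤-sum≢-1 y≢
        (0≤-+ (0≤-+ (0≤-+ (0≤-* 0≤α 1≤A) (0≤-* 0≤γ 0≤p)) (0≤-* 0≤α 0≤B)) (0≤-* 0≤γ 1≤q))
        (trans (e₁ α γ A B p q)
          (cong₂ (λ s t → t ℤ.- s ℤ.- 1ℤ)
            (e₂ x₁ A (ℤ.- p) (cong proj₁ eq)) (e₂ x₂ (ℤ.- B) q (cong proj₂ eq))))
        where
        e₁ : ∀ α γ A B p q →
          α ℤ.+ γ ℤ.- 1ℤ ℤ.+
            (α ℤ.* (A ℤ.- 1ℤ) ℤ.+ γ ℤ.* p ℤ.+ α ℤ.* B ℤ.+ γ ℤ.* (q ℤ.- 1ℤ)) ≡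
          γ ℤ.* q ℤ.- α ℤ.* (ℤ.- B) ℤ.- (γ ℤ.* (ℤ.- p) ℤ.- α ℤ.* A) ℤ.- 1ℤ
        e₁ = solve-∀
        e₂ : ∀ x u v → k ℤ.* (x ℤ.+ u) ≡ α ℤ.* x ℤ.+ β ℤ.* (x ℤ.+ u) ℤ.+ γ ℤ.* (x ℤ.+ u ℤ.+ v) →
          γ ℤ.* v ℤ.- α ℤ.* u ≡ 0ℤ
        e₂ x u v eq = trans (e α β γ x u v) (ℤ.i≡j⇒i-j≡0 (sym eq))
          where
          e : ∀ α β γ x u v → γ ℤ.* v ℤ.- α ℤ.* u ≡
            α ℤ.* x ℤ.+ β ℤ.* (x ℤ.+ u) ℤ.+ γ ℤ.* (x ℤ.+ u ℤ.+ v) ℤ.- (α ℤ.+ β ℤ.+ γ) ℤ.* (x ℤ.+ u)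
          e = solve-∀

      result : w ⊝ y ≡ 𝟘 ⊎ P (w ⊝ y) ⊎ P (⊖ (w ⊝ y)) → ⊥
      result (inj₁ w≡y) = w≢y (⊝≡𝟘⇒≡ w y w≡y)
      result (inj₂ (inj₁ y<w)) = proj₂ y→z w Qw y<w w<z
      result (inj₂ (inj₂ w<y)) = proj₂ x→y w Qw x<w
        (subst P (cong₂ _,_ (e w₁ (proj₁ y)) (e w₂ (proj₂ y))) w<y)
        where
        e : ∀ w y → ℤ.- (w ℤ.- y) ≡ y ℤ.- w
        e = solve-∀

    -- D • w = r • U ⊕ s • V places w in the parallelogram on U and V, so x ⊕ w or its
    -- mirror image z ⊝ w lies in the triangle x y z.
    no-point-in-parallelogram : ∀ D r s w → 0ℤ ℤ.≤ r → 0ℤ ℤ.≤ s →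
      0ℤ ℤ.≤ D ℤ.- r ℤ.- 1ℤ → 0ℤ ℤ.≤ D ℤ.- s ℤ.- 1ℤ →
      D • w ≡ r • U ⊕ s • V → r ≡ 0ℤ × s ≡ 0ℤ
    no-point-in-parallelogram D r s w@(w₁ , w₂) 0≤r 0≤s r<D s<D eq
      with 0≤i-or-i<0 (r ℤ.- s) | 0≤i-or-i<0 (r ℤ.- 1ℤ)
    ... | inj₁ s≤r | inj₂ r≤0 = 0≤∧<1⇒≡0 0≤r r≤0 ,
      ℤ.≤-antisym (ℤ.≤-trans (ℤ.0≤i-j⇒j≤i s≤r) (ℤ.≤-reflexive (0≤∧<1⇒≡0 0≤r r≤0))) 0≤s
    -- The weights come from regrouping `D • x ⊕ r • U ⊕ s • V` on the vertices `x`, `x ⊕ U`,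
    -- `x ⊕ U ⊕ V`. The mirror image below is regrouped likewise, with `D - r` and `D - s` in place
    -- of `r` and `s`.
    ... | inj₁ s≤r | inj₁ 1≤r = ⊥-elim (no-point-in-triangle (D ℤ.- r) (r ℤ.- s) s (x ⊕ w)
      (subst (0ℤ ℤ.≤_) (e₁ D r) (0≤-+ r<D (ℤ.+≤+ (ℕ.z≤n {1})))) s≤r 0≤s
      (subst (0ℤ ℤ.≤_) (e₂ r s) 1≤r)
      (subst (0ℤ ℤ.≤_) (e₃ D r s) s<D)
      (subst (0ℤ ℤ.≤_) (e₄ D r s) (0≤-+ r<D 0≤s))
      (cong₂ _,_ (e x₁ w₁ A (ℤ.- p) (cong proj₁ eq)) (e x₂ w₂ (ℤ.- B) q (cong proj₂ eq))))
      where
      e₁ : ∀ D r → D ℤ.- r ℤ.- 1ℤ ℤ.+ 1ℤ ≡ D ℤ.- r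
      e₁ = solve-∀
      e₂ : ∀ r s → r ℤ.- 1ℤ ≡ r ℤ.- s ℤ.+ s ℤ.- 1ℤ
      e₂ = solve-∀
      e₃ : ∀ D r s → D ℤ.- s ℤ.- 1ℤ ≡ D ℤ.- r ℤ.+ (r ℤ.- s) ℤ.- 1ℤ
      e₃ = solve-∀
      e₄ : ∀ D r s → D ℤ.- r ℤ.- 1ℤ ℤ.+ s ≡ D ℤ.- r ℤ.+ s ℤ.- 1ℤ
      e₄ = solve-∀
      e : ∀ x w u v → D ℤ.* w ≡ r ℤ.* u ℤ.+ s ℤ.* v →
        (D ℤ.- r ℤ.+ (r ℤ.- s) ℤ.+ s) ℤ.* (x ℤ.+ w) ≡
        (D ℤ.- r) ℤ.* x ℤ.+ (r ℤ.- s) ℤ.* (x ℤ.+ u) ℤ.+ s ℤ.* (x ℤ.+ u ℤ.+ v)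
      e x w u v eq = trans (l D r s x w) (trans (cong (λ t → D ℤ.* x ℤ.+ t) eq) (l′ D r s x u v))
        where
        l : ∀ D r s x w → (D ℤ.- r ℤ.+ (r ℤ.- s) ℤ.+ s) ℤ.* (x ℤ.+ w) ≡ D ℤ.* x ℤ.+ D ℤ.* w
        l = solve-∀
        l′ : ∀ D r s x u v → D ℤ.* x ℤ.+ (r ℤ.* u ℤ.+ s ℤ.* v) ≡
          (D ℤ.- r) ℤ.* x ℤ.+ (r ℤ.- s) ℤ.* (x ℤ.+ u) ℤ.+ s ℤ.* (x ℤ.+ u ℤ.+ v)
        l′ = solve-∀
    ... | inj₂ r<s | _ = ⊥-elim (no-point-in-triangle r (s ℤ.- r) (D ℤ.- s) (z ⊝ w)
      0≤r (subst (0ℤ ℤ.≤_) (e₀ r s) (0≤-+ r<s (ℤ.+≤+ (ℕ.z≤n {1}))))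
      (subst (0ℤ ℤ.≤_) (e₁ D s) (0≤-+ s<D (ℤ.+≤+ (ℕ.z≤n {1}))))
      (subst (0ℤ ℤ.≤_) (e₂ D r s) r<D)
      (subst (0ℤ ℤ.≤_) (e₃ r s) (0≤-+ 0≤r r<s))
      (subst (0ℤ ℤ.≤_) (e₄ D r s) (0≤-+ 0≤r s<D))
      (cong₂ _,_ (e x₁ w₁ A (ℤ.- p) (cong proj₁ eq)) (e x₂ w₂ (ℤ.- B) q (cong proj₂ eq))))
      where
      e₀ : ∀ r s → -1ℤ ℤ.- (r ℤ.- s) ℤ.+ 1ℤ ≡ s ℤ.- r
      e₀ = solve-∀
      e₁ : ∀ D r → D ℤ.- r ℤ.- 1ℤ ℤ.+ 1ℤ ≡ D ℤ.- r
      e₁ = solve-∀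
      e₂ : ∀ D r s → D ℤ.- r ℤ.- 1ℤ ≡ s ℤ.- r ℤ.+ (D ℤ.- s) ℤ.- 1ℤ
      e₂ = solve-∀
      e₃ : ∀ r s → r ℤ.+ (-1ℤ ℤ.- (r ℤ.- s)) ≡ r ℤ.+ (s ℤ.- r) ℤ.- 1ℤ
      e₃ = solve-∀
      e₄ : ∀ D r s → r ℤ.+ (D ℤ.- s ℤ.- 1ℤ) ≡ r ℤ.+ (D ℤ.- s) ℤ.- 1ℤ
      e₄ = solve-∀
      e : ∀ x w u v → D ℤ.* w ≡ r ℤ.* u ℤ.+ s ℤ.* v →
        (r ℤ.+ (s ℤ.- r) ℤ.+ (D ℤ.- s)) ℤ.* (x ℤ.+ u ℤ.+ v ℤ.- w) ≡
        r ℤ.* x ℤ.+ (s ℤ.- r) ℤ.* (x ℤ.+ u) ℤ.+ (D ℤ.- s) ℤ.* (x ℤ.+ u ℤ.+ v)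
      e x w u v eq = trans (l D r s (x ℤ.+ u ℤ.+ v) w)
        (trans (cong (λ t → D ℤ.* (x ℤ.+ u ℤ.+ v) ℤ.- t) eq) (l′ D r s x u v))
        where
        l : ∀ D r s z w → (r ℤ.+ (s ℤ.- r) ℤ.+ (D ℤ.- s)) ℤ.* (z ℤ.- w) ≡ D ℤ.* z ℤ.- D ℤ.* w
        l = solve-∀
        l′ : ∀ D r s x u v → D ℤ.* (x ℤ.+ u ℤ.+ v) ℤ.- (r ℤ.* u ℤ.+ s ℤ.* v) ≡
          r ℤ.* x ℤ.+ (s ℤ.- r) ℤ.* (x ℤ.+ u) ℤ.+ (D ℤ.- s) ℤ.* (x ℤ.+ u ℤ.+ v)
        l′ = solve-∀

    -- `m` and `n` are the Cramer coordinates of `(a , b)`, scaled by the determinant. Subtracting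
    -- an integer combination of `U` and `V` leaves their remainders modulo `d`. These describe a
    -- lattice point of the parallelogram, so they are 0.
    coordinates-divisible : ∀ d .{{_ : ℕ.NonZero d}} → D ≡ + d → ∀ a b → ∃₂ λ s t →
      q ℤ.* a ℤ.+ p ℤ.* b ≡ s ℤ.* + d × B ℤ.* a ℤ.+ A ℤ.* b ≡ t ℤ.* + d
    coordinates-divisible d D≡d a b =
      let r≡0 , s≡0 = no-point-in-parallelogram (+ d) (+ (m ℤ.%ℕ d)) (+ (n ℤ.%ℕ d))
            ((a , b) ⊝ (tm • U ⊕ tn • V))
            (ℤ.+≤+ ℕ.z≤n) (ℤ.+≤+ ℕ.z≤n) (rest m) (rest n)
            (cong₂ _,_
              (e A (ℤ.- p) a (e₁ A B p q a b)) (e (ℤ.- B) q b (e₂ A B p q a b)))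
      in tm , tn , exact m r≡0 , exact n s≡0
      where
      m n tm tn : ℤ
      m = q ℤ.* a ℤ.+ p ℤ.* b
      n = B ℤ.* a ℤ.+ A ℤ.* b
      tm = m ℤ./ℕ d
      tn = n ℤ./ℕ d
      exact : ∀ m → + (m ℤ.%ℕ d) ≡ 0ℤ → m ≡ (m ℤ./ℕ d) ℤ.* + d
      exact m r≡0 = trans (ℤ.a≡a%ℕn+[a/ℕn]*n m d)
        (trans (cong (λ t → t ℤ.+ (m ℤ./ℕ d) ℤ.* + d) r≡0) (ℤ.+-identityˡ _))
      rest : ∀ m → 0ℤ ℤ.≤ + d ℤ.- + (m ℤ.%ℕ d) ℤ.- 1ℤ
      rest m = subst (0ℤ ℤ.≤_) (l (+ d) (+ (m ℤ.%ℕ d)))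
        (ℤ.i≤j⇒0≤j-i (ℤ.+≤+ (ℤ.n%ℕd<d m d)))
        where
        l : ∀ d r → d ℤ.- (1ℤ ℤ.+ r) ≡ d ℤ.- r ℤ.- 1ℤ
        l = solve-∀
      e : ∀ u v c → D ℤ.* c ≡ m ℤ.* u ℤ.+ n ℤ.* v →
        + d ℤ.* (c ℤ.- (tm ℤ.* u ℤ.+ tn ℤ.* v)) ≡ + (m ℤ.%ℕ d) ℤ.* u ℤ.+ + (n ℤ.%ℕ d) ℤ.* v
      e u v c eq = trans (l₁ (+ d) c tm tn u v)
        (trans (cong (λ t → t ℤ.- + d ℤ.* (tm ℤ.* u ℤ.+ tn ℤ.* v)) (trans (cong (ℤ._* c) (sym D≡d)) eq))
        (trans (cong₂ (λ m n → m ℤ.* u ℤ.+ n ℤ.* v ℤ.- + d ℤ.* (tm ℤ.* u ℤ.+ tn ℤ.* v))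
                 (ℤ.a≡a%ℕn+[a/ℕn]*n m d) (ℤ.a≡a%ℕn+[a/ℕn]*n n d))
               (l₂ (+ d) (+ (m ℤ.%ℕ d)) (+ (n ℤ.%ℕ d)) tm tn u v)))
        where
        l₁ : ∀ d c tm tn u v → d ℤ.* (c ℤ.- (tm ℤ.* u ℤ.+ tn ℤ.* v)) ≡
          d ℤ.* c ℤ.- d ℤ.* (tm ℤ.* u ℤ.+ tn ℤ.* v)
        l₁ = solve-∀
        l₂ : ∀ d r s tm tn u v → (r ℤ.+ tm ℤ.* d) ℤ.* u ℤ.+ (s ℤ.+ tn ℤ.* d) ℤ.* v
          ℤ.- d ℤ.* (tm ℤ.* u ℤ.+ tn ℤ.* v) ≡ r ℤ.* u ℤ.+ s ℤ.* v
        l₂ = solve-∀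
      e₁ : ∀ A B p q a b → (A ℤ.* q ℤ.- B ℤ.* p) ℤ.* a ≡
        (q ℤ.* a ℤ.+ p ℤ.* b) ℤ.* A ℤ.+ (B ℤ.* a ℤ.+ A ℤ.* b) ℤ.* (ℤ.- p)
      e₁ = solve-∀
      e₂ : ∀ A B p q a b → (A ℤ.* q ℤ.- B ℤ.* p) ℤ.* b ≡
        (q ℤ.* a ℤ.+ p ℤ.* b) ℤ.* (ℤ.- B) ℤ.+ (B ℤ.* a ℤ.+ A ℤ.* b) ℤ.* q
      e₂ = solve-∀

    -- Otherwise D divides all four of A, B, p, q, so D² divides D.
    determinant≡1 : D ≡ 1ℤ
    determinant≡1 = go D refl (1≤determinant A B p q 0≤B 1≤q PU PV)
      where
      go : ∀ i → D ≡ i → 0ℤ ℤ.≤ i ℤ.- 1ℤ → D ≡ 1ℤ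
      go +[1+ n ] eq _ =
        let q′ , B′ , q≡ , B≡ = coordinates-divisible (suc n) eq 1ℤ 0ℤ
            p′ , A′ , p≡ , A≡ = coordinates-divisible (suc n) eq 0ℤ 1ℤ
        in trans eq (unit q′ B′ p′ A′
          (trans (sym (m*1 q p)) q≡) (trans (sym (m*1 B A)) B≡)
          (trans (sym (m*0 q p)) p≡) (trans (sym (m*0 B A)) A≡))
        where
        d : ℤ
        d = +[1+ n ]
        m*1 : ∀ a b → a ℤ.* 1ℤ ℤ.+ b ℤ.* 0ℤ ≡ a
        m*1 = solve-∀
        m*0 : ∀ a b → a ℤ.* 0ℤ ℤ.+ b ℤ.* 1ℤ ≡ b
        m*0 = solve-∀
        unit : ∀ q′ B′ p′ A′ → q ≡ q′ ℤ.* d → B ≡ B′ ℤ.* d → p ≡ p′ ℤ.* d → A ≡ A′ ℤ.* d → d ≡ 1ℤ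
        unit q′ B′ p′ A′ q≡ B≡ p≡ A≡ = cong +_
          (ℕ.m*n≡1⇒n≡1 ℤ.∣ c ∣ (suc n) (trans (sym (ℤ.abs-* c d)) (cong ℤ.∣_∣ c*d≡1)))
          where
          c : ℤ
          c = A′ ℤ.* q′ ℤ.- B′ ℤ.* p′
          l : ∀ A′ q′ B′ p′ d → A′ ℤ.* d ℤ.* (q′ ℤ.* d) ℤ.- B′ ℤ.* d ℤ.* (p′ ℤ.* d) ≡
            (A′ ℤ.* q′ ℤ.- B′ ℤ.* p′) ℤ.* d ℤ.* d
          l = solve-∀
          c*d≡1 : c ℤ.* d ≡ 1ℤ
          c*d≡1 = ℤ.*-cancelʳ-≡ (c ℤ.* d) 1ℤ d (trans (sym (l A′ q′ B′ p′ d))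
            (trans (sym (cong₂ ℤ._-_ (cong₂ ℤ._*_ A≡ q≡) (cong₂ ℤ._*_ B≡ p≡)))
            (trans eq (sym (ℤ.*-identityˡ d)))))

-- Limits of rational sequences

Sequence : Set
Sequence = ℕ → ℚ

Eventually : Pred ℕ 0ℓ → Set
Eventually Q = ∃ λ N → ∀ n → N ℕ.≤ n → Q n

record Null (f : Sequence) : Set where
  constructor mkNull
  field bound : ∀ ε → 0ℚ ℚ.< ε → Eventually λ n → ℚ.∣ f n ∣ ℚ.< ε

open Null

infix 4 _∼_

-- The relation `_≈_` on bare sequences, so that values of the linear form are compared with reals
-- without a Cauchy modulus.
record _∼_ (f g : Sequence) : Set where
  constructor mk∼
  field difference-null : Null (λ n → f n ℚ.- g n)

open _∼_ public

record EventuallyPositive (f : Sequence) : Set where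
  constructor mkPositive
  field
    {ε}   : ℚ
    0<ε   : 0ℚ ℚ.< ε
    above : Eventually λ n → ε ℚ.< f n

eventually-× : ∀ {Q R} → Eventually Q → Eventually R → Eventually λ n → Q n × R n
eventually-× (M , q) (N , r) = M ℕ.⊔ N , λ n M⊔N≤n →
  q n (ℕ.m⊔n≤o⇒m≤o M N M⊔N≤n) , r n (ℕ.m⊔n≤o⇒n≤o M N M⊔N≤n)

0<½*ε : ∀ {ε} → 0ℚ ℚ.< ε → 0ℚ ℚ.< ½ ℚ.* ε
0<½*ε {ε} 0<ε = subst (ℚ._< ½ ℚ.* ε) (ℚ.*-zeroʳ ½) (ℚ.*-monoʳ-<-pos ½ 0<ε)

½*ε+½*ε≡ε : ∀ ε → ½ ℚ.* ε ℚ.+ ½ ℚ.* ε ≡ ε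
½*ε+½*ε≡ε ε = trans (sym (ℚ.*-distribʳ-+ ε ½ ½)) (ℚ.*-identityˡ ε)

∣p∣<ε⇒-ε<p : ∀ {p ε} → 0ℚ ℚ.< ε → ℚ.∣ p ∣ ℚ.< ε → ℚ.- ε ℚ.< p
∣p∣<ε⇒-ε<p {p} {ε} 0<ε ∣p∣<ε with ℚ.∣p∣≡p∨∣p∣≡-p p
... | inj₁ ∣p∣≡p = ℚ.<-≤-trans (ℚ.neg-antimono-< 0<ε) (ℚ.∣p∣≡p⇒0≤p ∣p∣≡p)
... | inj₂ ∣p∣≡-p = subst (ℚ.- ε ℚ.<_) (solve 1 (λ p → :- (:- p) := p) refl p)
  (ℚ.neg-antimono-< (subst (ℚ._< ε) ∣p∣≡-p ∣p∣<ε))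
  where open +-*-Solver

null-resp : ∀ {f g} → (∀ n → f n ≡ g n) → Null f → Null g
null-resp f≗g null = mkNull λ ε 0<ε →
  let N , p = bound null ε 0<ε in N , λ n N≤n → subst (λ r → ℚ.∣ r ∣ ℚ.< ε) (f≗g n) (p n N≤n)

eventually-0⇒null : ∀ {f} → Eventually (λ n → f n ≡ 0ℚ) → Null f
eventually-0⇒null (N , p) = mkNull λ ε 0<ε →
  N , λ n N≤n → subst (λ r → ℚ.∣ r ∣ ℚ.< ε) (sym (p n N≤n)) 0<ε

null-neg : ∀ {f} → Null f → Null (λ n → ℚ.- f n)
null-neg {f} null = mkNull λ ε 0<ε →
  let N , p = bound null ε 0<ε
  in  N , λ n N≤n → subst (ℚ._< ε) (sym (ℚ.∣-p∣≡∣p∣ (f n))) (p n N≤n)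

null-+ : ∀ {f g} → Null f → Null g → Null (λ n → f n ℚ.+ g n)
null-+ {f} {g} null-f null-g = mkNull λ ε 0<ε →
  let N , p = eventually-× (bound null-f (½ ℚ.* ε) (0<½*ε 0<ε)) (bound null-g (½ ℚ.* ε) (0<½*ε 0<ε))
  in  N , λ n N≤n → let p₁ , p₂ = p n N≤n in
    ℚ.≤-<-trans (ℚ.∣p+q∣≤∣p∣+∣q∣ (f n) (g n))
      (subst (ℚ.∣ f n ∣ ℚ.+ ℚ.∣ g n ∣ ℚ.<_) (½*ε+½*ε≡ε ε) (ℚ.+-mono-< p₁ p₂))

-- The reciprocal `d` of `c` is an argument because the tolerance `ε` is scaled by it.
null-*ˡ : ∀ c d .{{_ : ℚ.Positive c}} .{{_ : ℚ.Positive d}} → c ℚ.* d ≡ 1ℚ →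
  ∀ {f} → Null f → Null (λ n → c ℚ.* f n)
null-*ˡ c d cd≡1 {f} null = mkNull λ ε 0<ε →
  let N , p = bound null (d ℚ.* ε) (subst (ℚ._< d ℚ.* ε) (ℚ.*-zeroʳ d) (ℚ.*-monoʳ-<-pos d 0<ε))
  in  N , λ n N≤n → begin-strict
    ℚ.∣ c ℚ.* f n ∣         ≡⟨ ℚ.∣p*q∣≡∣p∣*∣q∣ c (f n) ⟩
    ℚ.∣ c ∣ ℚ.* ℚ.∣ f n ∣   ≡⟨ cong (ℚ._* ℚ.∣ f n ∣) (ℚ.0≤p⇒∣p∣≡p (ℚ.<⇒≤ (ℚ.positive⁻¹ c))) ⟩
    c ℚ.* ℚ.∣ f n ∣         <⟨ ℚ.*-monoʳ-<-pos c (p n N≤n) ⟩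
    c ℚ.* (d ℚ.* ε)         ≡⟨ ℚ.*-assoc c d ε ⟨
    c ℚ.* d ℚ.* ε           ≡⟨ cong (ℚ._* ε) cd≡1 ⟩
    1ℚ ℚ.* ε                ≡⟨ ℚ.*-identityˡ ε ⟩
    ε                       ∎
  where open ℚ.≤-Reasoning

pos-resp : ∀ {f g} → (∀ n → f n ≡ g n) → EventuallyPositive f → EventuallyPositive g
pos-resp f≗g (mkPositive {ε} 0<ε (N , p)) =
  mkPositive 0<ε (N , λ n N≤n → subst (ε ℚ.<_) (f≗g n) (p n N≤n))

pos-+ : ∀ {f g} → EventuallyPositive f → EventuallyPositive g → EventuallyPositive (λ n → f n ℚ.+ g n)
pos-+ (mkPositive 0<ε pf) (mkPositive 0<η pg) =
  let N , p = eventually-× pf pg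
  in  mkPositive (ℚ.+-mono-< 0<ε 0<η) (N , λ n N≤n → let p₁ , p₂ = p n N≤n in ℚ.+-mono-< p₁ p₂)

pos-+-null : ∀ {f g} → EventuallyPositive f → Null g → EventuallyPositive (λ n → f n ℚ.+ g n)
pos-+-null {f} {g} (mkPositive {ε} 0<ε pf) null =
  let N , p = eventually-× pf (bound null (½ ℚ.* ε) (0<½*ε 0<ε))
  in  mkPositive (0<½*ε 0<ε) (N , λ n N≤n → let p₁ , p₂ = p n N≤n in
    subst (ℚ._< f n ℚ.+ g n) ε-½ε (ℚ.+-mono-< p₁ (∣p∣<ε⇒-ε<p (0<½*ε 0<ε) p₂)))
  where
  ε-½ε : ε ℚ.- ½ ℚ.* ε ≡ ½ ℚ.* ε
  ε-½ε = trans (cong (ℚ._- ½ ℚ.* ε) (sym (½*ε+½*ε≡ε ε)))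
    (solve 1 (λ h → h :+ h :- h := h) refl (½ ℚ.* ε))
    where open +-*-Solver

pos-*ˡ : ∀ c .{{_ : ℚ.Positive c}} {f} → EventuallyPositive f → EventuallyPositive (λ n → c ℚ.* f n)
pos-*ˡ c (mkPositive {ε} 0<ε (N , p)) =
  mkPositive (subst (ℚ._< c ℚ.* ε) (ℚ.*-zeroʳ c) (ℚ.*-monoʳ-<-pos c 0<ε))
    (N , λ n N≤n → ℚ.*-monoʳ-<-pos c (p n N≤n))

¬pos-0 : ¬ EventuallyPositive (λ _ → 0ℚ)
¬pos-0 (mkPositive 0<ε (N , p)) = ℚ.<-asym 0<ε (p N ℕ.≤-refl)

pos⇒¬null : ∀ {f} → EventuallyPositive f → ¬ Null f
pos⇒¬null {f} pos null = ¬pos-0 (pos-resp (λ n → ℚ.+-inverseʳ (f n)) (pos-+-null pos (null-neg null)))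

∼-refl : ∀ {f} → f ∼ f
∼-refl {f} = mk∼ (eventually-0⇒null (0 , λ n _ → ℚ.+-inverseʳ (f n)))

∼-reflexive : ∀ {f g} → (∀ n → f n ≡ g n) → f ∼ g
∼-reflexive {f} f≗g = mk∼ (null-resp (λ n → cong (λ t → f n ℚ.- t) (f≗g n)) (difference-null (∼-refl {f})))

∼-sym : ∀ {f g} → f ∼ g → g ∼ f
∼-sym {f} {g} (mk∼ f-g) = mk∼ (null-resp (λ n → swap-minus (f n) (g n)) (null-neg f-g))
  where
  open +-*-Solver
  swap-minus : ∀ a b → ℚ.- (a ℚ.- b) ≡ b ℚ.- a
  swap-minus = solve 2 (λ a b → :- (a :- b) := b :- a) refl

∼-trans : ∀ {f g h} → f ∼ g → g ∼ h → f ∼ h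
∼-trans {f} {g} {h} (mk∼ f-g) (mk∼ g-h) =
  mk∼ (null-resp (λ n → telescope (f n) (g n) (h n)) (null-+ f-g g-h))
  where
  open +-*-Solver
  telescope : ∀ a b c → a ℚ.- b ℚ.+ (b ℚ.- c) ≡ a ℚ.- c
  telescope = solve 3 (λ a b c → a :- b :+ (b :- c) := a :- c) refl

∼-minus : ∀ {f f′ g g′} → f ∼ f′ → g ∼ g′ → (λ n → f n ℚ.- g n) ∼ (λ n → f′ n ℚ.- g′ n)
∼-minus {f} {f′} {g} {g′} (mk∼ f-f′) (mk∼ g-g′) =
  mk∼ (null-resp (λ n → rearrange (f n) (f′ n) (g n) (g′ n)) (null-+ f-f′ (null-neg g-g′)))
  where
  open +-*-Solver
  rearrange : ∀ a b c d → a ℚ.- b ℚ.- (c ℚ.- d) ≡ a ℚ.- c ℚ.- (b ℚ.- d)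
  rearrange = solve 4 (λ a b c d → a :- b :- (c :- d) := a :- c :- (b :- d)) refl

pos-∼ : ∀ {f g} → f ∼ g → EventuallyPositive f → EventuallyPositive g
pos-∼ {f} {g} f∼g pos =
  pos-resp (λ n → cancel (f n) (g n)) (pos-+-null pos (difference-null (∼-sym f∼g)))
  where
  open +-*-Solver
  cancel : ∀ a b → a ℚ.+ (b ℚ.- a) ≡ b
  cancel = solve 2 (λ a b → a :+ (b :- a) := b) refl

pos⇒∣f∣∼f : ∀ {f} → EventuallyPositive f → (λ n → ℚ.∣ f n ∣) ∼ f
pos⇒∣f∣∼f {f} (mkPositive 0<ε (N , p)) = mk∼ (eventually-0⇒null (N , λ n N≤n →
  trans (cong (ℚ._- f n) (ℚ.0≤p⇒∣p∣≡p (ℚ.<⇒≤ (ℚ.<-trans 0<ε (p n N≤n))))) (ℚ.+-inverseʳ (f n))))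

≈⇒∼ : ∀ {x y} → x ≈ y → seq x ∼ seq y
≈⇒∼ x≈y = mk∼ (mkNull x≈y)

∼⇒≈ : ∀ {x y} → seq x ∼ seq y → x ≈ y
∼⇒≈ x∼y = bound (difference-null x∼y)

<⇒pos : ∀ {x y} → x < y → EventuallyPositive (λ n → seq y n ℚ.- seq x n)
<⇒pos {x} {y} (ε , 0<ε , N , p) = mkPositive 0<ε (N , λ n N≤n →
  subst (ℚ._< seq y n ℚ.- seq x n) (cancel (seq x n) ε) (ℚ.+-monoˡ-< (ℚ.- seq x n) (p n N≤n)))
  where
  open +-*-Solver
  cancel : ∀ a e → a ℚ.+ e ℚ.- a ≡ e
  cancel = solve 2 (λ a e → a :+ e :- a := e) refl

pos⇒< : ∀ {x y} → EventuallyPositive (λ n → seq y n ℚ.- seq x n) → x < y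
pos⇒< {x} {y} (mkPositive {ε} 0<ε (N , p)) = ε , 0<ε , N , λ n N≤n →
  subst (seq x n ℚ.+ ε ℚ.<_) (cancel (seq x n) (seq y n)) (ℚ.+-monoʳ-< (seq x n) (p n N≤n))
  where
  open +-*-Solver
  cancel : ∀ a b → a ℚ.+ (b ℚ.- a) ≡ b
  cancel = solve 2 (λ a b → a :+ (b :- a) := b) refl

-- The integers inside the rationals

ι : ℤ → ℚ
ι i = i ℚ./ 1

toℚᵘ-ι : ∀ i → ℚ.toℚᵘ (ι i) ℚᵘ.≃ mkℚᵘ i 0
toℚᵘ-ι i = ℚ.toℚᵘ-fromℚᵘ (mkℚᵘ i 0)

ι-+ : ∀ i j → ι (i ℤ.+ j) ≡ ι i ℚ.+ ι j
ι-+ i j = ℚ.toℚᵘ-injective (begin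
  ℚ.toℚᵘ (ι (i ℤ.+ j))                ≈⟨ toℚᵘ-ι (i ℤ.+ j) ⟩
  mkℚᵘ (i ℤ.+ j) 0                    ≈⟨ *≡* (l i j) ⟩
  mkℚᵘ i 0 ℚᵘ.+ mkℚᵘ j 0              ≈⟨ ℚᵘ.+-cong (toℚᵘ-ι i) (toℚᵘ-ι j) ⟨
  ℚ.toℚᵘ (ι i) ℚᵘ.+ ℚ.toℚᵘ (ι j)      ≈⟨ ℚ.toℚᵘ-homo-+ (ι i) (ι j) ⟨
  ℚ.toℚᵘ (ι i ℚ.+ ι j)                ∎)
  where
  open ℚᵘ.≃-Reasoning
  l : ∀ i j → (i ℤ.+ j) ℤ.* (1ℤ) ≡ (i ℤ.* 1ℤ ℤ.+ j ℤ.* 1ℤ) ℤ.* 1ℤ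
  l = solve-∀

ι-neg : ∀ i → ι (ℤ.- i) ≡ ℚ.- ι i
ι-neg i = ℚ.toℚᵘ-injective (begin
  ℚ.toℚᵘ (ι (ℤ.- i))   ≈⟨ toℚᵘ-ι (ℤ.- i) ⟩
  ℚᵘ.- mkℚᵘ i 0        ≈⟨ ℚᵘ.-‿cong (toℚᵘ-ι i) ⟨
  ℚᵘ.- ℚ.toℚᵘ (ι i)    ≈⟨ ℚ.toℚᵘ-homo‿- (ι i) ⟨
  ℚ.toℚᵘ (ℚ.- ι i)     ∎)
  where open ℚᵘ.≃-Reasoning

/-*-ι : ∀ i d → (i ℚ./ suc d) ℚ.* ι +[1+ d ] ≡ ι i
/-*-ι i d = ℚ.toℚᵘ-injective (begin
  ℚ.toℚᵘ ((i ℚ./ suc d) ℚ.* ι +[1+ d ])            ≈⟨ ℚ.toℚᵘ-homo-* (i ℚ./ suc d) (ι +[1+ d ]) ⟩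
  ℚ.toℚᵘ (i ℚ./ suc d) ℚᵘ.* ℚ.toℚᵘ (ι +[1+ d ])
    ≈⟨ ℚᵘ.*-cong (ℚ.toℚᵘ-fromℚᵘ (mkℚᵘ i d)) (toℚᵘ-ι +[1+ d ]) ⟩
  mkℚᵘ i d ℚᵘ.* mkℚᵘ +[1+ d ] 0
    ≈⟨ *≡* (trans (l i +[1+ d ]) (cong (λ t → i ℤ.* + t) (sym (ℕ.*-identityʳ (suc d))))) ⟩
  mkℚᵘ i 0                                         ≈⟨ toℚᵘ-ι i ⟨
  ℚ.toℚᵘ (ι i)                                     ∎)
  where
  open ℚᵘ.≃-Reasoning
  l : ∀ i d → i ℤ.* d ℤ.* 1ℤ ≡ i ℤ.* d
  l = solve-∀

ι-pos : ∀ n → ℚ.Positive (ι +[1+ n ])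
ι-pos n = ℚ.normalize-pos (suc n) 1

1/-pos : ∀ n → ℚ.Positive (+ 1 ℚ./ suc n)
1/-pos n = ℚ.normalize-pos 1 (suc n)

-- The linear form `a + bθ` and the position of fractions relative to θ

module LinearForm (θ : ℝ) where

  L : Point → Sequence
  L (a , b) n = ι a ℚ.+ ι b ℚ.* seq θ n

  P : Pred Point 0ℓ
  P v = EventuallyPositive (L v)

  L-⊕ : ∀ x y n → L (x ⊕ y) n ≡ L x n ℚ.+ L y n
  L-⊕ (a , b) (c , d) n = trans
    (cong₂ (λ s t → s ℚ.+ t ℚ.* seq θ n) (ι-+ a c) (ι-+ b d))
    (l (ι a) (ι b) (ι c) (ι d) (seq θ n))
    where
    open +-*-Solver
    l : ∀ a b c d t → a ℚ.+ c ℚ.+ (b ℚ.+ d) ℚ.* t ≡ a ℚ.+ b ℚ.* t ℚ.+ (c ℚ.+ d ℚ.* t)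
    l = solve 5 (λ a b c d t → a :+ c :+ (b :+ d) :* t := a :+ b :* t :+ (c :+ d :* t)) refl

  L-⊖ : ∀ x n → L (⊖ x) n ≡ ℚ.- L x n
  L-⊖ (a , b) n = trans
    (cong₂ (λ s t → s ℚ.+ t ℚ.* seq θ n) (ι-neg a) (ι-neg b))
    (l (ι a) (ι b) (seq θ n))
    where
    open +-*-Solver
    l : ∀ a b t → ℚ.- a ℚ.+ (ℚ.- b) ℚ.* t ≡ ℚ.- (a ℚ.+ b ℚ.* t)
    l = solve 3 (λ a b t → :- a :+ (:- b) :* t := :- (a :+ b :* t)) refl

  null-⊖ : ∀ x → Null (L x) → Null (L (⊖ x))
  null-⊖ x null = null-resp (λ n → sym (L-⊖ x n)) (null-neg null)

  L-⊝ : ∀ x y n → L (x ⊝ y) n ≡ L x n ℚ.- L y n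
  L-⊝ x y n = trans (L-⊕ x (⊖ y) n) (cong (L x n ℚ.+_) (L-⊖ y n))

  seq-· : ∀ j n → seq (j · θ) n ≡ ι (+ j) ℚ.* seq θ n
  seq-· zero    n = sym (ℚ.*-zeroˡ (seq θ n))
  seq-· (suc j) n = trans (cong (seq θ n ℚ.+_) (seq-· j n))
    (trans (l (ι (+ j)) (seq θ n)) (cong (ℚ._* seq θ n) (sym (ι-+ 1ℤ (+ j)))))
    where
    open +-*-Solver
    l : ∀ c t → t ℚ.+ c ℚ.* t ≡ (1ℚ ℚ.+ c) ℚ.* t
    l = solve 2 (λ c t → t :+ c :* t := (con 1ℚ :+ c) :* t) refl

  seq-+· : ∀ i j n → seq (fromℕ i + j · θ) n ≡ L (+ i , + j) n
  seq-+· i j n = cong (ι (+ i) ℚ.+_) (seq-· j n)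

  seq--· : ∀ i j n → seq (fromℕ i - j · θ) n ≡ L (+ i , ℤ.- (+ j)) n
  seq--· i j n = cong (ι (+ i) ℚ.+_) (trans (cong ℚ.-_ (seq-· j n))
    (trans (ℚ.neg-distribˡ-* (ι (+ j)) (seq θ n)) (cong (ℚ._* seq θ n) (sym (ι-neg (+ j))))))

  P-ι : ∀ n → P (+[1+ n ] , 0ℤ)
  P-ι n = pos-resp (λ k → sym (trans (cong (ι +[1+ n ] ℚ.+_) (ℚ.*-zeroˡ (seq θ k))) (ℚ.+-identityʳ _)))
    -- The bound has to be strict, so half of the constant serves as `ε`.
    (mkPositive (0<½*ε 0<ι) (0 , λ _ _ →
      subst₂ ℚ._<_ (ℚ.+-identityʳ _) (½*ε+½*ε≡ε (ι +[1+ n ]))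
        (ℚ.+-monoʳ-< (½ ℚ.* ι +[1+ n ]) (0<½*ε 0<ι))))
    where
    0<ι : 0ℚ ℚ.< ι +[1+ n ]
    0<ι = ℚ.positive⁻¹ _ {{ι-pos n}}

  private
    clear-denominator : ∀ a d n →
      ι +[1+ d ] ℚ.* (seq θ n ℚ.- (a ℚ./ suc d)) ≡ L (ℤ.- a , +[1+ d ]) n
    clear-denominator a d n = trans (l (ι +[1+ d ]) (seq θ n) (a ℚ./ suc d))
      (cong (ℚ._+ ι +[1+ d ] ℚ.* seq θ n) (trans (cong ℚ.-_ (/-*-ι a d)) (sym (ι-neg a))))
      where
      open +-*-Solver
      l : ∀ b t f → b ℚ.* (t ℚ.- f) ≡ ℚ.- (f ℚ.* b) ℚ.+ b ℚ.* t
      l = solve 3 (λ b t f → b :* (t :- f) := :- (f :* b) :+ b :* t) refl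

    restore-denominator : ∀ a d n →
      (+ 1 ℚ./ suc d) ℚ.* L (ℤ.- a , +[1+ d ]) n ≡ seq θ n ℚ.- (a ℚ./ suc d)
    restore-denominator a d n = trans (cong ((+ 1 ℚ./ suc d) ℚ.*_) (sym (clear-denominator a d n)))
      (trans (sym (ℚ.*-assoc (+ 1 ℚ./ suc d) (ι +[1+ d ]) _))
      (trans (cong (ℚ._* (seq θ n ℚ.- (a ℚ./ suc d))) (/-*-ι 1ℤ d)) (ℚ.*-identityˡ _)))

  -- For `b ≥ 1` a null form would make θ equal to `-a/b`; negation reduces `b < 0` to this, and
  -- `b = 0` leaves a constant sequence.
  irrational⇒L-injective : Irrational θ → ∀ x → Null (L x) → x ≡ 𝟘
  irrational⇒L-injective irr (a , +[1+ d ]) null = ⊥-elim (irr ((ℤ.- a) ℚ./ suc d ,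
    ∼⇒≈ {θ} {fromℚ ((ℤ.- a) ℚ./ suc d)} (mk∼ (null-resp
      (λ n → trans (cong (λ t → (+ 1 ℚ./ suc d) ℚ.* L (t , +[1+ d ]) n) (sym (ℤ.neg-involutive a)))
                           (restore-denominator (ℤ.- a) d n))
      (null-*ˡ (+ 1 ℚ./ suc d) (ι +[1+ d ]) {{1/-pos d}} {{ι-pos d}} (/-*-ι 1ℤ d) null)))))
  irrational⇒L-injective irr (a , -[1+ d ]) null =
    ⊥-elim (+[1+d]≢0 (cong proj₂ (irrational⇒L-injective irr (ℤ.- a , +[1+ d ]) (null-⊖ (a , -[1+ d ]) null))))
    where
    +[1+d]≢0 : +[1+ d ] ≢ 0ℤ
    +[1+d]≢0 ()
  irrational⇒L-injective irr (+[1+ n ] , + zero) null = ⊥-elim (pos⇒¬null (P-ι n) null)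
  irrational⇒L-injective irr (-[1+ n ] , + zero) null =
    ⊥-elim (pos⇒¬null (P-ι n) (null-⊖ (-[1+ n ] , 0ℤ) null))
  irrational⇒L-injective irr (+ zero , + zero) null = refl

  below⇒P : ∀ a b → FractionBelow a b θ → P (ℤ.- (+ a) , + b)
  below⇒P a (suc d) a/b<θ = pos-resp (clear-denominator (+ a) d)
    (pos-*ˡ (ι +[1+ d ]) {{ι-pos d}} (<⇒pos {fromℚ (+ a ℚ./ suc d)} {θ} a/b<θ))

  P⇒below : ∀ a d → P (ℤ.- (+ a) , +[1+ d ]) → FractionBelow a (suc d) θ
  P⇒below a d pos = pos⇒< {fromℚ (+ a ℚ./ suc d)} {θ}
    (pos-resp (restore-denominator (+ a) d) (pos-*ˡ (+ 1 ℚ./ suc d) {{1/-pos d}} pos))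

  private
    negate : ∀ a d n → L (+ a , -[1+ d ]) n ≡ ℚ.- L (ℤ.- (+ a) , +[1+ d ]) n
    negate a d n = trans (cong (λ t → L (t , -[1+ d ]) n) (sym (ℤ.neg-involutive (+ a))))
      (L-⊖ (ℤ.- (+ a) , +[1+ d ]) n)

    difference-neg : ∀ x y → ℚ.- (x ℚ.- y) ≡ y ℚ.- x
    difference-neg = solve 2 (λ x y → :- (x :- y) := y :- x) refl
      where open +-*-Solver

  above⇒P : ∀ a d → FractionAbove a (suc d) θ → P (+ a , -[1+ d ])
  above⇒P a d θ<a/b = pos-resp
    (λ n → trans (l (ι +[1+ d ]) (seq θ n) (+ a ℚ./ suc d))
      (trans (cong ℚ.-_ (clear-denominator (+ a) d n)) (sym (negate a d n))))
    (pos-*ˡ (ι +[1+ d ]) {{ι-pos d}} (<⇒pos {θ} {fromℚ (+ a ℚ./ suc d)} θ<a/b))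
    where
    open +-*-Solver
    l : ∀ b t f → b ℚ.* (f ℚ.- t) ≡ ℚ.- (b ℚ.* (t ℚ.- f))
    l = solve 3 (λ b t f → b :* (f :- t) := :- (b :* (t :- f))) refl

  P⇒above : ∀ a b → P (+ a , ℤ.- (+ b)) → FractionAbove a b θ
  P⇒above a zero    _   = _
  P⇒above a (suc d) pos = pos⇒< {θ} {fromℚ (+ a ℚ./ suc d)} (pos-resp
    (λ n → trans (cong ((+ 1 ℚ./ suc d) ℚ.*_) (negate a d n))
      (trans (sym (ℚ.neg-distribʳ-* (+ 1 ℚ./ suc d) _))
      (trans (cong ℚ.-_ (restore-denominator (+ a) d n)) (difference-neg (seq θ n) (+ a ℚ./ suc d)))))
    (pos-*ˡ (+ 1 ℚ./ suc d) {{1/-pos d}} pos))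

≈-refl : ∀ {x} → x ≈ x
≈-refl {x} = ∼⇒≈ {x} {x} ∼-refl

≈-sym : ∀ {x y} → x ≈ y → y ≈ x
≈-sym {x} {y} x≈y = ∼⇒≈ {y} {x} (∼-sym (≈⇒∼ {x} {y} x≈y))

≈-trans : ∀ {x y z} → x ≈ y → y ≈ z → x ≈ z
≈-trans {x} {y} {z} x≈y y≈z = ∼⇒≈ {x} {z} (∼-trans (≈⇒∼ {x} {y} x≈y) (≈⇒∼ {y} {z} y≈z))

-- Labels and factors

module Label (δ : ℕ → ℝ) where

  DistinctBefore-functional : ∀ {n c d} → DistinctBefore δ n c → DistinctBefore δ n d → c ≡ d
  DistinctBefore-functional none none = refl
  DistinctBefore-functional (old D _) (old E _) = DistinctBefore-functional D E
  DistinctBefore-functional (new D _) (new E _) = cong suc (DistinctBefore-functional D E)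
  DistinctBefore-functional (old _ (k , k<n , eq)) (new _ isNew) = ⊥-elim (isNew k k<n eq)
  DistinctBefore-functional (new _ isNew) (old _ (k , k<n , eq)) = ⊥-elim (isNew k k<n eq)

  -- The first occurrence at `m` raises the count by one, and counts never decrease. Hence different
  -- first occurrences carry different labels.
  DistinctBefore-< : ∀ {m n c d} → IsNew δ m → m ℕ.< n →
    DistinctBefore δ m c → DistinctBefore δ n d → c ℕ.< d
  DistinctBefore-< isNew m<n C (old {n} D (k , k<n , eq)) with ℕ.m<1+n⇒m<n∨m≡n m<n
  ... | inj₁ m<n′ = DistinctBefore-< isNew m<n′ C D
  ... | inj₂ refl = ⊥-elim (isNew k k<n eq)
  DistinctBefore-< isNew m<n C (new {n} D _) with ℕ.m<1+n⇒m<n∨m≡n m<n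
  ... | inj₁ m<n′ = ℕ.m<n⇒m<1+n (DistinctBefore-< isNew m<n′ C D)
  ... | inj₂ refl = ℕ.s≤s (ℕ.≤-reflexive (DistinctBefore-functional C D))

  HasLabel-functional : ∀ {x y c d} → x ≈ y → HasLabel δ x c → HasLabel δ y d → c ≡ d
  HasLabel-functional {x} {y} x≈y (m , δm≈x , new-m , C) (n , δn≈y , new-n , D) with ℕ.<-cmp m n
  ... | tri≈ _ refl _ = DistinctBefore-functional C D
  ... | tri< m<n _ _ = ⊥-elim (new-n m m<n
    (≈-trans {δ m} {x} {δ n} δm≈x (≈-trans {x} {y} {δ n} x≈y (≈-sym {δ n} {y} δn≈y))))
  ... | tri> _ _ n<m = ⊥-elim (new-m n n<m
    (≈-trans {δ n} {y} {δ m} δn≈y (≈-sym {δ m} {y} (≈-trans {δ m} {x} {y} δm≈x x≈y))))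

  HasLabel-injective : ∀ {x y c} → HasLabel δ x c → HasLabel δ y c → x ≈ y
  HasLabel-injective {x} {y} (m , δm≈x , new-m , C) (n , δn≈y , new-n , D) with ℕ.<-cmp m n
  ... | tri≈ _ refl _ = ≈-trans {x} {δ m} {y} (≈-sym {δ m} {x} δm≈x) δn≈y
  ... | tri< m<n _ _ = ⊥-elim (ℕ.<-irrefl refl (DistinctBefore-< new-m m<n C D))
  ... | tri> _ _ n<m = ⊥-elim (ℕ.<-irrefl refl (DistinctBefore-< new-n n<m D C))

  module _ {Λ : ℕ → ℕ} (isΛ : IsLambdaWord δ Λ) {U V u v}
    (U-label : HasLabel δ U u) (V-label : HasLabel δ V v) where

    factor⇒successive : IsFactorOf (u ∷ v ∷ []) Λ → ∃ λ n → δ n ≈ U × δ (suc n) ≈ V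
    factor⇒successive (n , eq) = n ,
      HasLabel-injective {δ n} {U} (subst (HasLabel δ (δ n)) Λn≡u (isΛ n)) U-label ,
      HasLabel-injective {δ (suc n)} {V} (subst (HasLabel δ (δ (suc n))) Λ[1+n]≡v (isΛ (suc n))) V-label
      where
      Λn≡u : Λ n ≡ u
      Λn≡u = trans (cong Λ (sym (ℕ.+-identityʳ n))) (List.∷-injectiveˡ eq)
      Λ[1+n]≡v : Λ (suc n) ≡ v
      Λ[1+n]≡v = trans (cong Λ (ℕ.+-comm 1 n)) (List.∷-injectiveˡ (List.∷-injectiveʳ eq))

    successive⇒factor : (∃ λ n → δ n ≈ U × δ (suc n) ≈ V) → IsFactorOf (u ∷ v ∷ []) Λ
    successive⇒factor (n , δn≈U , δ[1+n]≈V) = n , cong₂ (λ a b → a ∷ b ∷ [])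
      (trans (cong Λ (ℕ.+-identityʳ n)) (HasLabel-functional {δ n} {U} δn≈U (isΛ n) U-label))
      (trans (cong Λ (ℕ.+-comm n 1)) (HasLabel-functional {δ (suc n)} {V} δ[1+n]≈V (isΛ (suc n)) V-label))

-- Lattice identities and pairs of consecutive gaps

x⊝x≡𝟘 : ∀ x → x ⊝ x ≡ 𝟘
x⊝x≡𝟘 (a , b) = cong₂ _,_ (ℤ.+-inverseʳ a) (ℤ.+-inverseʳ b)

⊖-⊝ : ∀ x y → ⊖ (x ⊝ y) ≡ y ⊝ x
⊖-⊝ (a , b) (c , d) = cong₂ _,_ (neg a c) (neg b d)
  where
  neg : ∀ a c → ℤ.- (a ℤ.- c) ≡ c ℤ.- a
  neg = solve-∀

⊝-⊕-⊝ : ∀ x y z → (x ⊝ y) ⊕ (y ⊝ z) ≡ x ⊝ z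
⊝-⊕-⊝ (a , b) (c , d) (e , f) = cong₂ _,_ (telescope a c e) (telescope b d f)
  where
  telescope : ∀ a c e → a ℤ.- c ℤ.+ (c ℤ.- e) ≡ a ℤ.- e
  telescope = solve-∀

x⊕[y⊝x]≡y : ∀ x y → x ⊕ (y ⊝ x) ≡ y
x⊕[y⊝x]≡y (a , b) (c , d) = cong₂ _,_ (cancel a c) (cancel b d)
  where
  cancel : ∀ a c → a ℤ.+ (c ℤ.- a) ≡ c
  cancel = solve-∀

-- Positive and negative parts, coordinate by coordinate. Through it any lattice point is a
-- difference of two enumerated points.
quadrant-difference : ∀ x → ∃₂ λ y z → Quadrant y × Quadrant z × y ⊝ z ≡ x
quadrant-difference (a , b) =
  (pos a , pos b) , (neg a , neg b) , (0≤pos a , 0≤pos b) , (0≤neg a , 0≤neg b) ,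
  cong₂ _,_ (pos-neg a) (pos-neg b)
  where
  pos neg : ℤ → ℤ
  pos (+ n)    = + n
  pos -[1+ n ] = 0ℤ
  neg (+ n)    = 0ℤ
  neg -[1+ n ] = +[1+ n ]
  0≤pos : ∀ i → 0ℤ ℤ.≤ pos i
  0≤pos (+ n)    = ℤ.+≤+ ℕ.z≤n
  0≤pos -[1+ n ] = ℤ.+≤+ ℕ.z≤n
  0≤neg : ∀ i → 0ℤ ℤ.≤ neg i
  0≤neg (+ n)    = ℤ.+≤+ ℕ.z≤n
  0≤neg -[1+ n ] = ℤ.+≤+ ℕ.z≤n
  pos-neg : ∀ i → pos i ℤ.- neg i ≡ i
  pos-neg (+ n)    = ℤ.+-identityʳ (+ n)
  pos-neg -[1+ n ] = refl

-- The middle point is the witness, since it is the point that the construction places on an axis.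
Corner : Pred Point 0ℓ → Point → Point → Set
Corner P U V = ∃ λ y → Quadrant (y ⊝ U) × Quadrant y × Quadrant (y ⊕ V) ×
  Consecutive P (y ⊝ U) y × Consecutive P y (y ⊕ V)

swap-Corner : ∀ {P U V} → Corner (λ x → P (swap x)) U V → Corner P (swap U) (swap V)
swap-Corner {P} {U} {V} (y , Qx , Qy , Qz , x→y , y→z) =
  swap y , swap Qx , swap Qy , swap Qz ,
  swap-Consecutive {P} {y ⊝ U} {y} x→y , swap-Consecutive {P} {y} {y ⊕ V} y→z

-- The choice is `M = max(A, p)`; it stays below `A + p` because `A` and `p` are both at least 1.
opposite⇒corner : ∀ {P} (cone : IsPositiveCone P) {A B p q} →
  0ℤ ℤ.≤ B → 0ℤ ℤ.≤ p ℤ.- 1ℤ → P (A , ℤ.- B) → P (ℤ.- p , q) →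
  A ℤ.* q ℤ.- B ℤ.* p ≡ 1ℤ → (B ≡ 0ℤ → P ((A , ℤ.- B) ⊝ (ℤ.- p , q))) →
  Corner P (A , ℤ.- B) (ℤ.- p , q)
opposite⇒corner {P} cone {A} {B} {p} {q} 0≤B 1≤p PU PV det V<U =
  choose (0≤i-or-i<0 (A ℤ.- p))
  where
  open Cone cone
  1≤A : 0ℤ ℤ.≤ A ℤ.- 1ℤ
  1≤A = P⇒1≤fst (0≤-neg-neg 0≤B) PU
  1≤q : 0ℤ ℤ.≤ q ℤ.- 1ℤ
  1≤q = P⇒1≤snd (0≤-neg-neg (0≤-pred p 1≤p)) PV
  corner-at : ∀ M → 0ℤ ℤ.≤ M ℤ.- A → 0ℤ ℤ.≤ M ℤ.- p → 0ℤ ℤ.≤ A ℤ.+ p ℤ.- 1ℤ ℤ.- M →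
    Corner P (A , ℤ.- B) (ℤ.- p , q)
  corner-at M A≤M p≤M M<A+p = (M , 0ℤ) ,
    Realisation.opposite-steps cone A B p q 1≤A 0≤B 1≤p 1≤q PU PV det V<U M A≤M p≤M M<A+p
  choose : 0ℤ ℤ.≤ A ℤ.- p ⊎ 0ℤ ℤ.≤ -1ℤ ℤ.- (A ℤ.- p) → Corner P (A , ℤ.- B) (ℤ.- p , q)
  choose (inj₁ p≤A) = corner-at A (ℤ.i≤j⇒0≤j-i (ℤ.≤-refl {A})) p≤A (subst (0ℤ ℤ.≤_) (e A p) 1≤p)
    where
    e : ∀ A p → p ℤ.- 1ℤ ≡ A ℤ.+ p ℤ.- 1ℤ ℤ.- A
    e = solve-∀
  choose (inj₂ A<p) = corner-at p (subst (0ℤ ℤ.≤_) (e₁ A p) (0≤-+ A<p (ℤ.+≤+ (ℕ.z≤n {1}))))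
    (ℤ.i≤j⇒0≤j-i (ℤ.≤-refl {p})) (subst (0ℤ ℤ.≤_) (e₂ A p) 1≤A)
    where
    e₁ : ∀ A p → -1ℤ ℤ.- (A ℤ.- p) ℤ.+ 1ℤ ≡ p ℤ.- A
    e₁ = solve-∀
    e₂ : ∀ A p → A ℤ.- 1ℤ ≡ A ℤ.+ p ℤ.- 1ℤ ℤ.- p
    e₂ = solve-∀

∣⊖∣≡∣-∣ : ∀ m n → ℤ.∣ m ℤ.⊖ n ∣ ≡ ℕ.∣ m - n ∣
∣⊖∣≡∣-∣ m n with ℕ.≤-total m n
... | inj₁ m≤n = trans (ℤ.∣⊖∣-≤ m≤n) (sym (ℕ.m≤n⇒∣m-n∣≡n∸m m≤n))
... | inj₂ n≤m = trans (ℤ.∣m⊖n∣≡∣n⊖m∣ m n) (trans (ℤ.∣⊖∣-≤ n≤m) (sym (ℕ.m≤n⇒∣n-m∣≡n∸m n≤m)))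

∣determinant∣ : ∀ A B p q → ℤ.∣ + A ℤ.* + q ℤ.- + B ℤ.* + p ∣ ≡ ℕ.∣ A ℕ.* q - B ℕ.* p ∣
∣determinant∣ A B p q = trans
  (cong ℤ.∣_∣ (trans (cong₂ ℤ._-_ (sym (ℤ.pos-* A q)) (sym (ℤ.pos-* B p)))
    (ℤ.m-n≡m⊖n (A ℕ.* q) (B ℕ.* p))))
  (∣⊖∣≡∣-∣ (A ℕ.* q) (B ℕ.* p))

1≤i∧∣i∣≡1⇒i≡1 : ∀ {i} → 0ℤ ℤ.≤ i ℤ.- 1ℤ → ℤ.∣ i ∣ ≡ 1 → i ≡ 1ℤ
1≤i∧∣i∣≡1⇒i≡1 {i} 1≤i ∣i∣≡1 = trans (sym (ℤ.0≤i⇒+∣i∣≡i (0≤-pred i 1≤i))) (cong +_ ∣i∣≡1)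

-- Steps of a walk through consecutive points of the quadrant

module Walk {P : Pred Point 0ℓ} (cone : IsPositiveCone P)
  (z : ℕ → Point) (Qz : ∀ n → Quadrant (z n)) (z→z : ∀ n → Consecutive P (z n) (z (suc n)))
  where
  open IsPositiveCone cone
  open Cone cone

  step : ℕ → Point
  step n = z (suc n) ⊝ z n

  IsStep : Pred Point 0ℓ
  IsStep u = ∃ λ n → step n ≡ u

  -- A translate of each point by 1 lies in the quadrant.
  step≤1 : ∀ {u} → IsStep u → ¬ P (u ⊝ (1ℤ , 0ℤ))
  step≤1 (n , refl) pos = proj₂ (z→z n) (z n ⊕ (1ℤ , 0ℤ))
    (0≤-+ (proj₁ (Qz n)) (ℤ.+≤+ ℕ.z≤n) , 0≤-+ (proj₂ (Qz n)) (ℤ.+≤+ ℕ.z≤n))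
    (subst P (cong₂ _,_ (e₁ (proj₁ (z n)) 1ℤ) (e₁ (proj₂ (z n)) 0ℤ)) P-e₁)
    (subst P (cong₂ _,_
      (e₂ (proj₁ (z (suc n))) (proj₁ (z n)) 1ℤ) (e₂ (proj₂ (z (suc n))) (proj₂ (z n)) 0ℤ)) pos)
    where
    e₁ : ∀ x e → e ≡ x ℤ.+ e ℤ.- x
    e₁ = solve-∀
    e₂ : ∀ y x e → y ℤ.- x ℤ.- e ≡ y ℤ.- (x ℤ.+ e)
    e₂ = solve-∀

  horizontal-step : ∀ {a} → 0ℤ ℤ.≤ a ℤ.- 1ℤ → IsStep (a , 0ℤ) → a ≡ 1ℤ
  horizontal-step {a} 1≤a isStep with 0≤i-or-i<0 (a ℤ.- 1ℤ ℤ.- 1ℤ)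
  ... | inj₁ 2≤a = ⊥-elim (step≤1 isStep
    (subst P (cong₂ _,_ (ℤ.*-identityʳ (a ℤ.- 1ℤ)) (ℤ.*-zeroʳ (a ℤ.- 1ℤ))) (P-• (a ℤ.- 1ℤ) 2≤a P-e₁)))
  ... | inj₂ a<2 = ℤ.i-j≡0⇒i≡j a 1ℤ (0≤∧<1⇒≡0 1≤a a<2)

  -- Such a step would have value `bθ`, and `bθ - 1 = (θ - 1) + (b - 1)θ` is positive, against the
  -- bound 1 on steps.
  vertical-step : ∀ {b} → P (-1ℤ , 1ℤ) → 0ℤ ℤ.≤ b ℤ.- 1ℤ → ¬ IsStep (0ℤ , b)
  vertical-step {b} P[-1,1] 1≤b isStep = step≤1 isStep (subst P (cong₂ _,_ (e₁ b) (e₂ b))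
    (P-comb 1ℤ (b ℤ.- 1ℤ) (ℤ.+≤+ ℕ.z≤n) 1≤b (subst (0ℤ ℤ.≤_) (e₃ b) 1≤b) P[-1,1] P-e₂))
    where
    e₁ : ∀ b → 1ℤ ℤ.* -1ℤ ℤ.+ (b ℤ.- 1ℤ) ℤ.* 0ℤ ≡ 0ℤ ℤ.- 1ℤ
    e₁ = solve-∀
    e₂ : ∀ b → 1ℤ ℤ.* 1ℤ ℤ.+ (b ℤ.- 1ℤ) ℤ.* 1ℤ ≡ b ℤ.- 0ℤ
    e₂ = solve-∀
    e₃ : ∀ b → b ℤ.- 1ℤ ≡ 1ℤ ℤ.+ (b ℤ.- 1ℤ) ℤ.- 1ℤ
    e₃ = solve-∀

  -- A horizontal step has value 1, the largest possible. This supplies the condition `V<U` of the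
  -- degenerate case `B = 0`.
  step<horizontal : ∀ {a v} → 0ℤ ℤ.≤ a ℤ.- 1ℤ → IsStep (a , 0ℤ) → IsStep v → (a , 0ℤ) ≢ v →
    P ((a , 0ℤ) ⊝ v)
  step<horizontal {a} {v} 1≤a u-step v-step u≢v with horizontal-step 1≤a u-step
  ... | refl with trichotomy ((1ℤ , 0ℤ) ⊝ v)
  ...   | inj₁ u⊝v≡𝟘 = ⊥-elim (u≢v (⊝≡𝟘⇒≡ _ v u⊝v≡𝟘))
  ...   | inj₂ (inj₁ v<u) = v<u
  ...   | inj₂ (inj₂ u<v) = ⊥-elim (step≤1 v-step (subst P (⊖-⊝ (1ℤ , 0ℤ) v) u<v))

  module _ {n : ℕ} {U V : Point} (step-n≡U : step n ≡ U) (step-1+n≡V : step (suc n) ≡ V) where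

    z⊕U : z n ⊕ U ≡ z (suc n)
    z⊕U = trans (cong (z n ⊕_) (sym step-n≡U)) (x⊕[y⊝x]≡y (z n) (z (suc n)))

    z⊕U⊕V : z n ⊕ U ⊕ V ≡ z (suc (suc n))
    z⊕U⊕V = trans (cong₂ _⊕_ z⊕U (sym step-1+n≡V)) (x⊕[y⊝x]≡y (z (suc n)) (z (suc (suc n))))

    z→z⊕U : Consecutive P (z n) (z n ⊕ U)
    z→z⊕U = subst (Consecutive P (z n)) (sym z⊕U) (z→z n)

    z⊕U→z⊕U⊕V : Consecutive P (z n ⊕ U) (z n ⊕ U ⊕ V)
    z⊕U→z⊕U⊕V = subst₂ (Consecutive P) (sym z⊕U) (sym z⊕U⊕V) (z→z (suc n))

    Q[z⊕U⊕V] : Quadrant (z n ⊕ U ⊕ V)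
    Q[z⊕U⊕V] = subst Quadrant (sym z⊕U⊕V) (Qz (suc (suc n)))

  -- The point `z n ⊕ V` is in the quadrant: its first coordinate exceeds that of `z n` by `p`, and
  -- its second exceeds that of `z n ⊕ U ⊕ V` by `B`.
  successive-same-side : ∀ {n A B p q} → 0ℤ ℤ.≤ B → 0ℤ ℤ.≤ p →
    step n ≡ (A , ℤ.- B) → step (suc n) ≡ (p , ℤ.- q) → (A , ℤ.- B) ≡ (p , ℤ.- q)
  successive-same-side {n} {A} {B} {p} {q} 0≤B 0≤p eq₁ eq₂ =
    same-side (z→z⊕U eq₁ eq₂) (z⊕U→z⊕U⊕V eq₁ eq₂)
      (0≤-+ (proj₁ (Qz n)) 0≤p ,
       subst (0ℤ ℤ.≤_) (drop-B (proj₂ (z n)) B q) (0≤-+ (proj₂ (Q[z⊕U⊕V] eq₁ eq₂)) 0≤B))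
    where
    drop-B : ∀ x B q → x ℤ.+ (ℤ.- B) ℤ.+ (ℤ.- q) ℤ.+ B ≡ x ℤ.+ (ℤ.- q)
    drop-B = solve-∀

  successive-opposite : ∀ {n A B p q} → 0ℤ ℤ.≤ B → 0ℤ ℤ.≤ p → P (A , ℤ.- B) → P (ℤ.- p , q) →
    step n ≡ (A , ℤ.- B) → step (suc n) ≡ (ℤ.- p , q) → A ℤ.* q ℤ.- B ℤ.* p ≡ 1ℤ
  successive-opposite {n} {A} {B} {p} {q} 0≤B 0≤p PU PV eq₁ eq₂ =
    Unimodularity.determinant≡1 cone A B p q (P⇒1≤fst (0≤-neg-neg 0≤B) PU) 0≤B 0≤p
      (P⇒1≤snd (0≤-neg-neg 0≤p) PV) PU PV (proj₁ (z n)) (proj₂ (z n))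
      (Qz n) (subst Quadrant (sym (z⊕U eq₁ eq₂)) (Qz (suc n))) (Q[z⊕U⊕V] eq₁ eq₂)
      (z→z⊕U eq₁ eq₂) (z⊕U→z⊕U⊕V eq₁ eq₂)

  module _ (P[-1,1] : P (-1ℤ , 1ℤ)) (A B p q : ℕ) (∣D∣≡1 : ℕ.∣ A ℕ.* q - B ℕ.* p ∣ ≡ 1) where

    -- Two degenerate cases need the walk: `p = 0` would make `V` a vertical step, and for `B = 0`
    -- the step `U` is the longest one.
    above-below⇒corner : (let U = + A , ℤ.- (+ B)) (let V = ℤ.- (+ p) , + q) →
      IsStep U → IsStep V → U ≢ V → P U → P V → Corner P U V
    above-below⇒corner U-step V-step U≢V PU PV = go p refl
      where
      go : ∀ p′ → p′ ≡ p → Corner P (+ A , ℤ.- (+ B)) (ℤ.- (+ p) , + q)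
      go zero    refl = ⊥-elim (vertical-step P[-1,1] (P⇒1≤snd ℤ.≤-refl PV) V-step)
      go (suc _) refl = opposite⇒corner cone (ℤ.+≤+ ℕ.z≤n) (ℤ.+≤+ ℕ.z≤n) PU PV
        (1≤i∧∣i∣≡1⇒i≡1
          (1≤determinant (+ A) (+ B) (+ p) (+ q) (ℤ.+≤+ ℕ.z≤n) (P⇒1≤snd (ℤ.+≤+ ℕ.z≤n) PV) PU PV)
          (trans (∣determinant∣ A B p q) ∣D∣≡1))
        V<U
        where
        V<U : + B ≡ 0ℤ → P ((+ A , ℤ.- (+ B)) ⊝ (ℤ.- (+ p) , + q))
        V<U refl = step<horizontal (P⇒1≤fst ℤ.≤-refl PU) U-step V-step U≢V

    -- Reflection turns this into the previous situation with `(B , A , q , p)`, provided `q ≥ 1`.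
    -- If `q = 0`, then `V` is the step 1, the determinant gives `B = 1`, and `1 < θ < 2` gives
    -- `A = 1`: exactly the excluded pair.
    below-above⇒corner : (let U = ℤ.- (+ A) , + B) (let V = + p , ℤ.- (+ q)) → P (+ 2 , -1ℤ) →
      IsStep U → IsStep V → P U → P V → ¬ (U ≡ (-1ℤ , 1ℤ) × V ≡ (1ℤ , 0ℤ)) → Corner P U V
    below-above⇒corner P[2,-1] U-step V-step PU PV excluded = go q refl
      where
      vertical : ∀ A′ → A′ ≡ A → + A′ ≡ 0ℤ → ⊥
      vertical zero refl _ = vertical-step P[-1,1] (P⇒1≤snd ℤ.≤-refl PU) U-step

      P-U : ∀ A′ B′ → A′ ≡ A → B′ ≡ B → P (ℤ.- (+ A′) , + B′)
      P-U A′ B′ refl refl = PU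

      A≡1 : B ≡ 1 → ∀ A′ → A′ ≡ A → A ≡ 1
      A≡1 B≡1 zero eq = ⊥-elim (vertical 0 eq refl)
      A≡1 B≡1 (suc zero) eq = sym eq
      -- For `A = 2 + k` the value of `U` would be `θ - A = -(k + (2 - θ))`.
      A≡1 B≡1 (suc (suc k)) eq = ⊥-elim (¬P-neg-comb (+ k) 1ℤ (ℤ.+≤+ ℕ.z≤n) (ℤ.+≤+ ℕ.z≤n) P-e₁ P[2,-1]
        (cong₂ _,_ (e₁ (+ k)) (e₂ (+ k))) (P-U (suc (suc k)) 1 eq (sym B≡1)))
        where
        e₁ : ∀ k → ℤ.- (+ 2 ℤ.+ k) ≡ (ℤ.- k) ℤ.* 1ℤ ℤ.+ (ℤ.- 1ℤ) ℤ.* + 2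
        e₁ = solve-∀
        e₂ : ∀ k → 1ℤ ≡ (ℤ.- k) ℤ.* 0ℤ ℤ.+ (ℤ.- 1ℤ) ℤ.* -1ℤ
        e₂ = solve-∀

      go : ∀ q′ → q′ ≡ q → Corner P (ℤ.- (+ A) , + B) (+ p , ℤ.- (+ q))
      go zero refl = ⊥-elim (excluded
        (cong₂ (λ a b → ℤ.- (+ a) , + b) (A≡1 B≡1 A refl) B≡1 , cong (λ i → + i , 0ℤ) p≡1))
        where
        p≡1 : p ≡ 1
        p≡1 = ℤ.+-injective (horizontal-step (P⇒1≤fst ℤ.≤-refl PV) V-step)
        B≡1 : B ≡ 1
        B≡1 = trans (sym (cong₂ ℕ.∣_-_∣ (ℕ.*-zeroʳ A) (trans (cong (B ℕ.*_) p≡1) (ℕ.*-identityʳ B)))) ∣D∣≡1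
      go (suc _) refl = swap-Corner {P} (opposite⇒corner (swap-cone cone) {+ B} {+ A} {+ q} {+ p}
        (ℤ.+≤+ ℕ.z≤n) (ℤ.+≤+ ℕ.z≤n) PU PV
        (1≤i∧∣i∣≡1⇒i≡1
          (Cone.1≤determinant (swap-cone cone) (+ B) (+ A) (+ q) (+ p)
            (ℤ.+≤+ ℕ.z≤n) (P⇒1≤fst (0≤-neg-neg {+ q} (ℤ.+≤+ ℕ.z≤n)) PV) PU PV)
          (trans (∣determinant∣ B A q p) (trans (ℕ.∣-∣-comm (B ℕ.* p) (A ℕ.* q)) ∣D∣≡1)))
        -- After the reflection the degenerate case is `A = 0`, where `U` would be vertical.
        (λ A≡0 → ⊥-elim (vertical A refl A≡0)))

-- The lattice points of the increasing enumeration

module Enumeration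
  (θ : ℝ) (irr : Irrational θ) (1<θ : fromℕ 1 < θ) (θ<2 : θ < fromℕ 2)
  (s : ℕ → ℝ) (enum : IsIncreasingEnumeration (S θ) s) where

  open IsIncreasingEnumeration enum
  open LinearForm θ

  δ : ℕ → ℝ
  δ = differences s

  ∼-L⊝ : ∀ {f g x y} → f ∼ L x → g ∼ L y → (λ n → f n ℚ.- g n) ∼ L (x ⊝ y)
  ∼-L⊝ {x = x} {y} f∼x g∼y = ∼-trans (∼-minus f∼x g∼y) (∼-reflexive (λ n → sym (L-⊝ x y n)))

  L-injective : ∀ x y → L x ∼ L y → x ≡ y
  L-injective x y x∼y = ⊝≡𝟘⇒≡ x y (irrational⇒L-injective irr (x ⊝ y)
    (null-resp (λ n → sym (L-⊝ x y n)) (difference-null x∼y)))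

  z : ℕ → Point
  z n = let i , j , _ = sound n in + i , + j

  z-quadrant : ∀ n → Quadrant (z n)
  z-quadrant n = ℤ.+≤+ ℕ.z≤n , ℤ.+≤+ ℕ.z≤n

  s∼z : ∀ n → seq (s n) ∼ L (z n)
  s∼z n = let i , j , sn≈ = sound n in
    ∼-trans (≈⇒∼ {s n} {fromℕ i + j · θ} sn≈) (∼-reflexive (seq-+· i j))

  z-complete : ∀ w → Quadrant w → ∃ λ n → z n ≡ w
  z-complete (+ i , + j) _ =
    let x = fromℕ i + j · θ
        n , sn≈x = complete x (i , j , ≈-refl {x})
    in  n , L-injective (z n) (+ i , + j) (∼-trans (∼-sym (s∼z n))
          (∼-trans (≈⇒∼ {s n} {x} sn≈x) (∼-reflexive (seq-+· i j))))

  P-closed : ∀ {x y} → P x → P y → P (x ⊕ y)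
  P-closed {x} {y} Px Py = pos-resp (λ n → sym (L-⊕ x y n)) (pos-+ Px Py)

  δ∼step : ∀ n → seq (δ n) ∼ L (z (suc n) ⊝ z n)
  δ∼step n = ∼-L⊝ {x = z (suc n)} {z n} (s∼z (suc n)) (s∼z n)

  P-step : ∀ n → P (z (suc n) ⊝ z n)
  P-step n = pos-∼ (δ∼step n) (<⇒pos {s n} {s (suc n)} (increasing n))

  z-mono : ∀ {m n} → m ℕ.< n → P (z n ⊝ z m)
  z-mono {m} {suc n} m<1+n with ℕ.m<1+n⇒m<n∨m≡n m<1+n
  ... | inj₂ refl = P-step m
  ... | inj₁ m<n  = subst P (⊝-⊕-⊝ (z (suc n)) (z n) (z m))
    (P-closed {z (suc n) ⊝ z n} {z n ⊝ z m} (P-step n) (z-mono m<n))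

  P[1,0] : P (1ℤ , 0ℤ)
  P[1,0] = P-ι 0

  P[-1,1] : P (-1ℤ , 1ℤ)
  P[-1,1] = below⇒P 1 1 1<θ

  P[2,-1] : P (+ 2 , -1ℤ)
  P[2,-1] = above⇒P 2 0 θ<2

  -- The order of Cauchy reals is not decidable constructively, so the sign of `a + bθ` is read off
  -- the enumeration: two quadrant points with difference `x` occur as terms, and their indices are
  -- compared.
  P-trichotomy : ∀ x → x ≡ 𝟘 ⊎ P x ⊎ P (⊖ x)
  P-trichotomy x with quadrant-difference x
  ... | y , w , Qy , Qw , refl with z-complete y Qy | z-complete w Qw
  ...   | m , refl | n , refl with ℕ.<-cmp m n
  ...     | tri< m<n _ _ = inj₂ (inj₂ (subst P (sym (⊖-⊝ (z m) (z n))) (z-mono m<n)))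
  ...     | tri≈ _ refl _ = inj₁ (x⊝x≡𝟘 (z m))
  ...     | tri> _ _ n<m = inj₂ (inj₁ (z-mono n<m))

  cone : IsPositiveCone P
  cone = record
    { ⊕-closed   = λ {x} {y} → P-closed {x} {y}
    ; trichotomy = P-trichotomy
    ; ¬P𝟘        = λ P𝟘 → ¬pos-0 (pos-resp (λ n → trans (ℚ.+-identityˡ _) (ℚ.*-zeroˡ (seq θ n))) P𝟘)
    ; P-e₁       = P[1,0]
    ; P-e₂       = P-closed {1ℤ , 0ℤ} { -1ℤ , 1ℤ} P[1,0] P[-1,1]
    }

  open IsPositiveCone cone using (¬P𝟘; P-e₂)
  open Cone cone

  z-reflects : ∀ m n → P (z n ⊝ z m) → m ℕ.< n
  z-reflects m n pos with ℕ.<-cmp m n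
  ... | tri< m<n _ _ = m<n
  ... | tri≈ _ refl _ = ⊥-elim (¬P𝟘 (subst P (x⊝x≡𝟘 (z m)) pos))
  ... | tri> _ _ n<m = ⊥-elim (P⇒¬P⊖ {z n ⊝ z m} pos (subst P (sym (⊖-⊝ (z n) (z m))) (z-mono n<m)))

  z-injective : ∀ m n → z m ≡ z n → m ≡ n
  z-injective m n eq with ℕ.<-cmp m n
  ... | tri≈ _ m≡n _ = m≡n
  ... | tri< m<n _ _ = ⊥-elim (¬P𝟘 (subst P (trans (cong (z n ⊝_) eq) (x⊝x≡𝟘 (z n))) (z-mono m<n)))
  ... | tri> _ _ n<m = ⊥-elim (¬P𝟘 (subst P (trans (cong (_⊝ z n) eq) (x⊝x≡𝟘 (z n))) (z-mono n<m)))

  z-consecutive : ∀ n → Consecutive P (z n) (z (suc n))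
  z-consecutive n = P-step n , gap
    where
    gap : ∀ w → Quadrant w → P (w ⊝ z n) → ¬ P (z (suc n) ⊝ w)
    gap w Qw above below with z-complete w Qw
    ... | m , refl = ℕ.<⇒≱ (z-reflects n m above) (ℕ.m<1+n⇒m≤n (z-reflects m (suc n) below))

  open Walk cone z z-quadrant z-consecutive

  consecutive⇒z : ∀ {x y} → Quadrant x → Quadrant y → Consecutive P x y →
    ∃ λ n → z n ≡ x × z (suc n) ≡ y
  consecutive⇒z {x} {y} Qx Qy (x<y , gap) with z-complete x Qx | z-complete y Qy
  ... | m , refl | n , refl with ℕ.<-cmp (suc m) n
  ...   | tri≈ _ refl _ = m , refl , refl
  ...   | tri< 1+m<n _ _ = ⊥-elim (gap (z (suc m)) (z-quadrant (suc m)) (P-step m) (z-mono 1+m<n))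
  ...   | tri> _ _ n<1+m = ⊥-elim (ℕ.<⇒≱ (z-reflects m n x<y) (ℕ.m<1+n⇒m≤n n<1+m))

  consecutive-steps⇒z : ∀ {x y w} → Quadrant x → Quadrant y → Quadrant w →
    Consecutive P x y → Consecutive P y w →
    ∃ λ n → z n ≡ x × z (suc n) ≡ y × z (suc (suc n)) ≡ w
  consecutive-steps⇒z Qx Qy Qw x→y y→w with consecutive⇒z Qx Qy x→y | consecutive⇒z Qy Qw y→w
  ... | m , zm≡x , z[1+m]≡y | n , zn≡y , z[1+n]≡w with z-injective (suc m) n (trans z[1+m]≡y (sym zn≡y))
  ...   | refl = m , zm≡x , z[1+m]≡y , z[1+n]≡w

  δ≈⇒step : ∀ {U u} → seq U ∼ L u → ∀ n → δ n ≈ U → z (suc n) ⊝ z n ≡ u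
  δ≈⇒step {U} {u} U∼u n δn≈U = L-injective _ u
    (∼-trans (∼-sym (δ∼step n)) (∼-trans (≈⇒∼ {δ n} {U} δn≈U) U∼u))

  step⇒δ≈ : ∀ {U u} → seq U ∼ L u → ∀ n → z (suc n) ⊝ z n ≡ u → δ n ≈ U
  step⇒δ≈ {U} U∼u n refl = ∼⇒≈ {δ n} {U} (∼-trans (δ∼step n) (∼-sym U∼u))

  -- The points 0, 1, θ are successive terms, and the first of them has index 0 because no quadrant
  -- point lies below `𝟘`.
  initial-points : z 0 ≡ 𝟘 × z 1 ≡ (1ℤ , 0ℤ) × z 2 ≡ (0ℤ , 1ℤ)
  initial-points = go (consecutive-steps⇒z
    (ℤ.≤-refl , ℤ.≤-refl) (ℤ.+≤+ ℕ.z≤n , ℤ.≤-refl) (ℤ.≤-refl , ℤ.+≤+ ℕ.z≤n)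
    (proj₁ steps) (proj₂ steps))
    where
    steps : Consecutive P 𝟘 (1ℤ , 0ℤ) × Consecutive P (1ℤ , 0ℤ) (0ℤ , 1ℤ)
    steps = Realisation.initial-steps cone P[-1,1] P[2,-1]
    go : (∃ λ n → z n ≡ 𝟘 × z (suc n) ≡ (1ℤ , 0ℤ) × z (suc (suc n)) ≡ (0ℤ , 1ℤ)) →
      z 0 ≡ 𝟘 × z 1 ≡ (1ℤ , 0ℤ) × z 2 ≡ (0ℤ , 1ℤ)
    go (zero  , points) = points
    go (suc n , zn≡𝟘 , _) = ⊥-elim (quadrant⇒¬P⊖ (z 0) (z-quadrant 0)
      (subst (λ x → P (x ⊝ z 0)) zn≡𝟘 (z-mono (ℕ.s≤s (ℕ.z≤n {n})))))

  module _ {U : ℝ} (U-value : IsValueOf δ U) (A B : ℕ) (U≈ : U ≈ ∣ fromℕ A - B · θ ∣) where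

    private
      u : Point
      u = + A , ℤ.- (+ B)

      U∼ : seq U ∼ λ n → ℚ.∣ L u n ∣
      U∼ = ∼-trans (≈⇒∼ {U} {∣ fromℕ A - B · θ ∣} U≈) (∼-reflexive (λ n → cong ℚ.∣_∣ (seq--· A B n)))

    -- The sign inside the absolute value tells on which side of θ the fraction `A/B` lies. It is
    -- not zero, since differences are positive.
    value-side : (P (+ A , ℤ.- (+ B)) × seq U ∼ L (+ A , ℤ.- (+ B))) ⊎
                 (P (ℤ.- (+ A) , + B) × seq U ∼ L (ℤ.- (+ A) , + B))
    value-side with P-trichotomy u
    ... | inj₂ (inj₁ Pu) = inj₁ (Pu , ∼-trans U∼ (pos⇒∣f∣∼f Pu))
    ... | inj₂ (inj₂ P⊖u) = inj₂ (subst (λ v → P v × seq U ∼ L v)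
      (cong (ℤ.- (+ A) ,_) (ℤ.neg-involutive (+ B)))
      (P⊖u , ∼-trans U∼ (∼-trans
        (∼-reflexive (λ n → trans (sym (ℚ.∣-p∣≡∣p∣ (L u n))) (cong ℚ.∣_∣ (sym (L-⊖ u n)))))
        (pos⇒∣f∣∼f P⊖u))))
    ... | inj₁ u≡𝟘 = ⊥-elim (¬P𝟘 (subst P step≡𝟘 (P-step (proj₁ U-value))))
      where
      L𝟘≡0 : ∀ n → ℚ.∣ L 𝟘 n ∣ ≡ L 𝟘 n
      L𝟘≡0 n = ℚ.0≤p⇒∣p∣≡p (ℚ.≤-reflexive (sym (trans (ℚ.+-identityˡ _) (ℚ.*-zeroˡ (seq θ n)))))
      step≡𝟘 : z (suc (proj₁ U-value)) ⊝ z (proj₁ U-value) ≡ 𝟘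
      step≡𝟘 = δ≈⇒step {U} (∼-trans U∼ (∼-trans
        (∼-reflexive (λ n → cong (λ v → ℚ.∣ L v n ∣) u≡𝟘)) (∼-reflexive L𝟘≡0)))
        (proj₁ U-value) (proj₂ U-value)

  corner⇒step : ∀ {U V} → Corner P U V → ∃ λ n → step n ≡ U × step (suc n) ≡ V
  corner⇒step {U} {V} (y , Qx , Qy , Qz , x→y , y→z) =
    let n , zn≡ , z[1+n]≡ , z[2+n]≡ = consecutive-steps⇒z Qx Qy Qz x→y y→z
    in  n , trans (cong₂ _⊝_ z[1+n]≡ zn≡) (cong₂ _,_ (e₁ (proj₁ y) (proj₁ U)) (e₁ (proj₂ y) (proj₂ U))) ,
            trans (cong₂ _⊝_ z[2+n]≡ z[1+n]≡) (cong₂ _,_ (e₂ (proj₁ y) (proj₁ V)) (e₂ (proj₂ y) (proj₂ V)))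
    where
    e₁ : ∀ y u → y ℤ.- (y ℤ.- u) ≡ u
    e₁ = solve-∀
    e₂ : ∀ y v → y ℤ.+ v ℤ.- y ≡ v
    e₂ = solve-∀

  P⇒below′ : ∀ a b → P (ℤ.- (+ a) , + b) → FractionBelow a b θ
  P⇒below′ a zero    pos = ⊥-elim (¬P[-,0] a pos)
  P⇒below′ a (suc d) pos = P⇒below a d pos

  below⇒¬P : ∀ a b → FractionBelow a b θ → ¬ P (+ a , ℤ.- (+ b))
  below⇒¬P a b below pos = P-opposite (+ a) (+ b) pos (below⇒P a b below)

  above⇒¬P : ∀ a b → FractionAbove a b θ → ¬ P (ℤ.- (+ a) , + b)
  above⇒¬P a zero    _     pos = ¬P[-,0] a pos
  above⇒¬P a (suc d) above pos = P-opposite (+ a) (+ suc d) (above⇒P a d above) pos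

  open Label δ

  label-0 : HasLabel δ (δ 0) 0
  label-0 = 0 , ≈-refl {δ 0} , (λ _ ()) , none

  step-0 : step 0 ≡ (1ℤ , 0ℤ)
  step-0 = cong₂ _⊝_ (proj₁ (proj₂ initial-points)) (proj₁ initial-points)

  step-1 : step 1 ≡ (-1ℤ , 1ℤ)
  step-1 = cong₂ _⊝_ (proj₂ (proj₂ initial-points)) (proj₁ (proj₂ initial-points))

  label-1 : HasLabel δ (δ 1) 1
  label-1 = 1 , ≈-refl {δ 1} , isNew , new none (λ _ ())
    where
    1≢-1 : 1ℤ ≢ -1ℤ
    1≢-1 ()
    isNew : IsNew δ 1
    isNew k k<1 δk≈δ1 = 1≢-1 (cong proj₁ (trans (sym step-0)
      (trans (cong step (sym (ℕ.n<1⇒n≡0 k<1)))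
      (trans (δ≈⇒step {δ 1} (δ∼step 1) k δk≈δ1) step-1))))

  module _ {U V : ℝ} (U-value : IsValueOf δ U) (V-value : IsValueOf δ V) (U≉V : ¬ (U ≈ V))
    (A B p q : ℕ) (U≈ : U ≈ ∣ fromℕ A - B · θ ∣) (V≈ : V ≈ ∣ fromℕ p - q · θ ∣) where

    private
      value⇒step : ∀ {W w} → IsValueOf δ W → seq W ∼ L w → IsStep w
      value⇒step {W} (n , δn≈W) W∼w = n , δ≈⇒step {W} W∼w n δn≈W

      values-differ : ∀ {a b} → seq U ∼ L a → seq V ∼ L b → a ≢ b
      values-differ U∼ V∼ refl = U≉V (∼⇒≈ {U} {V} (∼-trans U∼ (∼-sym V∼)))

      U-side = value-side {U} U-value A B U≈
      V-side = value-side {V} V-value p q V≈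

    successive⇒unimodular : (∃ λ n → δ n ≈ U × δ (suc n) ≈ V) →
      OppositeSides θ A B p q × ℕ.∣ A ℕ.* q - B ℕ.* p ∣ ≡ 1
    successive⇒unimodular (n , δn≈U , δ[1+n]≈V) = go U-side V-side
      where
      0≤+ : ∀ {m} → 0ℤ ℤ.≤ + m
      0≤+ = ℤ.+≤+ ℕ.z≤n
      -- The reflected walk handles `U` below θ; the two lemmas taken from it hold for every
      -- positive cone.
      module Swapped = Walk (swap-cone cone) (λ n → swap (z n)) (λ n → swap (z-quadrant n))
        (λ n → swap-Consecutive {λ x → P (swap x)} {z n} {z (suc n)} (z-consecutive n))
      go : _ → _ → OppositeSides θ A B p q × ℕ.∣ A ℕ.* q - B ℕ.* p ∣ ≡ 1
      go (inj₁ (_ , U∼)) (inj₁ (_ , V∼)) = ⊥-elim (values-differ U∼ V∼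
        (successive-same-side {n} {+ A} {+ B} {+ p} {+ q} 0≤+ 0≤+
          (δ≈⇒step {U} U∼ n δn≈U) (δ≈⇒step {V} V∼ (suc n) δ[1+n]≈V)))
      go (inj₂ (_ , U∼)) (inj₂ (_ , V∼)) = ⊥-elim (values-differ U∼ V∼ (cong swap
        (Swapped.successive-same-side {n} {+ B} {+ A} {+ q} {+ p} 0≤+ 0≤+
          (cong swap (δ≈⇒step {U} U∼ n δn≈U)) (cong swap (δ≈⇒step {V} V∼ (suc n) δ[1+n]≈V)))))
      go (inj₁ (PU , U∼)) (inj₂ (PV , V∼)) =
        inj₂ (P⇒above A B PU , P⇒below′ p q PV) ,
        trans (sym (∣determinant∣ A B p q)) (cong ℤ.∣_∣
          (successive-opposite {n} {+ A} {+ B} {+ p} {+ q} 0≤+ 0≤+ PU PV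
            (δ≈⇒step {U} U∼ n δn≈U) (δ≈⇒step {V} V∼ (suc n) δ[1+n]≈V)))
      go (inj₂ (PU , U∼)) (inj₁ (PV , V∼)) =
        inj₁ (P⇒below′ A B PU , P⇒above p q PV) ,
        trans (ℕ.∣-∣-comm (A ℕ.* q) (B ℕ.* p)) (trans (sym (∣determinant∣ B A q p)) (cong ℤ.∣_∣
          (Swapped.successive-opposite {n} {+ B} {+ A} {+ q} {+ p} 0≤+ 0≤+ PU PV
            (cong swap (δ≈⇒step {U} U∼ n δn≈U)) (cong swap (δ≈⇒step {V} V∼ (suc n) δ[1+n]≈V)))))

    unimodular⇒successive : ¬ (δ 1 ≈ U × δ 0 ≈ V) →
      OppositeSides θ A B p q → ℕ.∣ A ℕ.* q - B ℕ.* p ∣ ≡ 1 → ∃ λ n → δ n ≈ U × δ (suc n) ≈ V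
    unimodular⇒successive excluded sides ∣D∣≡1 = go U-side V-side sides
      where
      realise : ∀ {a b} → seq U ∼ L a → seq V ∼ L b → Corner P a b → ∃ λ n → δ n ≈ U × δ (suc n) ≈ V
      realise U∼ V∼ corner =
        let n , eq₁ , eq₂ = corner⇒step corner
        in  n , step⇒δ≈ {U} U∼ n eq₁ , step⇒δ≈ {V} V∼ (suc n) eq₂
      go : _ → _ → OppositeSides θ A B p q → ∃ λ n → δ n ≈ U × δ (suc n) ≈ V
      go (inj₁ (PU , _)) (inj₁ _) (inj₁ (U-below , _)) = ⊥-elim (below⇒¬P A B U-below PU)
      go (inj₁ _) (inj₁ (PV , _)) (inj₂ (_ , V-below)) = ⊥-elim (below⇒¬P p q V-below PV)
      go (inj₂ _) (inj₂ (PV , _)) (inj₁ (_ , V-above)) = ⊥-elim (above⇒¬P p q V-above PV)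
      go (inj₂ (PU , _)) (inj₂ _) (inj₂ (U-above , _)) = ⊥-elim (above⇒¬P A B U-above PU)
      go (inj₁ (PU , U∼)) (inj₂ (PV , V∼)) _ = realise U∼ V∼
        (above-below⇒corner P[-1,1] A B p q ∣D∣≡1
          (value⇒step {U} U-value U∼) (value⇒step {V} V-value V∼) (values-differ U∼ V∼) PU PV)
      go (inj₂ (PU , U∼)) (inj₁ (PV , V∼)) _ = realise U∼ V∼
        (below-above⇒corner P[-1,1] A B p q ∣D∣≡1 P[2,-1]
          (value⇒step {U} U-value U∼) (value⇒step {V} V-value V∼) PU PV
          λ (u≡ , v≡) → excluded
            (step⇒δ≈ {U} U∼ 1 (trans step-1 (sym u≡)) , step⇒δ≈ {V} V∼ 0 (trans step-0 (sym v≡))))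

theorem5 : (θ : ℝ) → Irrational θ → fromℕ 1 < θ → θ < fromℕ 2 →
    (s : ℕ → ℝ) → IsIncreasingEnumeration (S θ) s →
    (Λ : ℕ → ℕ) → IsLambdaWord (differences s) Λ →
    (U V : ℝ) → IsValueOf (differences s) U → IsValueOf (differences s) V → ¬ (U ≈ V) →
    (u v : ℕ) → HasLabel (differences s) U u → HasLabel (differences s) V v →
    (A B p q : ℕ) → U ≈ ∣ fromℕ A - B · θ ∣ → V ≈ ∣ fromℕ p - q · θ ∣ →
    u ∷ v ∷ [] ≢ 1 ∷ 0 ∷ [] →
    IsFactorOf (u ∷ v ∷ []) Λ ⇔ (OppositeSides θ A B p q × ℕ.∣ A ℕ.* q - B ℕ.* p ∣ ≡ 1)
theorem5 θ irr 1<θ θ<2 s enum Λ isΛ U V U-value V-value U≉V u v U-label V-label A B p q U≈ V≈ uv≢10 =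
  mk⇔
    (λ factor → successive⇒unimodular {U} {V} U-value V-value U≉V A B p q U≈ V≈
      (factor⇒successive isΛ {U} {V} U-label V-label factor))
    (λ (sides , ∣D∣≡1) → successive⇒factor isΛ {U} {V} U-label V-label
      (unimodular⇒successive {U} {V} U-value V-value U≉V A B p q U≈ V≈ excluded sides ∣D∣≡1))
  where
  open Enumeration θ irr 1<θ θ<2 s enum
  open Label δ
  -- In terms of values the word `10` is the pair `δ 1`, `δ 0`, that is, `θ - 1` followed by `1`.
  excluded : ¬ (δ 1 ≈ U × δ 0 ≈ V)
  excluded (δ1≈U , δ0≈V) = uv≢10 (cong₂ (λ a b → a ∷ b ∷ [])
    (sym (HasLabel-functional {δ 1} {U} δ1≈U label-1 U-label))
    (sym (HasLabel-functional {δ 0} {V} δ0≈V label-0 V-label)))
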